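{- The graph $\Gamma$, whose vertices are the elliptic ovoids of the symplectic subquadrangles of the Hermitian surface $\mathcal{H}(3,4)$ of $\mathrm{PG}(3,4)$, two vertices being adjacent whenever they meet in exactly one point and their symplectic subquadrangles meet in exactly six points, is a strongly regular graph with parameters $(216, 40, 4, 8)$.
   Context: A strongly regular graph with parameters $(v,k,\lambda,\mu)$ is a simple, undirected, connected graph with $v$ vertices such that each vertex lies on $k$ edges, any two adjacent vertices have exactly $\lambda$ common neighbours, and any two distinct non-adjacent vertices have exactly $\mu$ common neighbours. Let $\perp$ be a non-degenerate unitary polarity of $\mathrm{PG}(3,4)$ and let $\mathcal{H}(3,4)$ be the Hermitian surface it defines, i.e. the incidence structure of the points and lines of $\mathrm{PG}(3,4)$ that are totally isotropic with respect to $\perp$ (it has $45$ points and $27$ lines, and is a generalized quadrangle of order $(4,2)$). Symplectic subquadrangles: let $\Sigma$ be a Baer subgeometry of $\mathrm{PG}(3,4)$, i.e. a subgeometry isomorphic to $\mathrm{PG}(3,2)$, and let $\mathcal{W}=\mathcal{W}(3,2)$ be the incidence structure of all points of $\Sigma$ (there are $15$) and of the $15$ lines of $\Sigma$ (called generators of $\mathcal{W}$) that are totally isotropic with respect to a non-degenerate symplectic polarity of $\Sigma$. This polarity extends uniquely to a symplectic polarity $\tilde{\perp}$ of $\mathrm{PG}(3,4)$. $\mathcal{W}$ is called a symplectic subquadrangle of $\mathcal{H}(3,4)$ if $\tilde{\perp}\perp=\perp\tilde{\perp}=\sigma$, where $\sigma$ is a semilinear involution whose set of fixed points is $\Sigma$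 (so all points of $\Sigma$ lie on $\mathcal{H}(3,4)$ and $\perp$, $\tilde{\perp}$ induce the same polarity on $\Sigma$). For two symplectic subquadrangles $\mathcal{W},\mathcal{W}'$, the intersection $\mathcal{W}\cap\mathcal{W}'$ denotes the set of their common points; "meeting in $n$ points" means $|\mathcal{W}\cap\mathcal{W}'|=n$. Elliptic ovoids: an elliptic ovoid of $\mathcal{W}$ is an elliptic quadric $\mathcal{Q}^-(3,2)$ of $\Sigma$ (a set of $5$ points) such that the lines of $\Sigma$ tangent to it (meeting it in exactly one point) are precisely the $15$ generators of $\mathcal{W}$. An elliptic quadric of $\Sigma$ determines a unique symplectic quadrangle $\mathcal{W}$ of $\Sigma$ in this way, called the symplectic subquadrangle of the elliptic ovoid. -}

module Defs where

open import Algebra.Bundles using (CommutativeRing; RawRing)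
open import Algebra.Morphism.Structures using (IsRingIsomorphism)
open import Algebra.Structures using (IsCommutativeRing)
open import Data.Bool.Base using (Bool; true; false)
open import Data.Bool.Properties using (xor-∧-commutativeRing)
open import Data.Fin.Base using (Fin)
open import Data.Nat.Base using (ℕ; suc)
open import Data.Product.Base using (Σ; ∃; _×_; _,_; proj₁; proj₂)
open import Data.Sum.Base using (_⊎_)
open import Data.Vec.Base using (Vec; map; zipWith; foldr′; replicate)
open import Data.Vec.Properties using (map-cong; map-id; map-∘; map-const)
open import Function.Base using (id; _∘_)
open import Function.Bundles using (Inverse; _⇔_)
open import Level using (0ℓ; _⊔_)
open import Relation.Binary.Bundles using (Setoid)
open import Relation.Binary.Construct.Closure.ReflexiveTransitive using (Star)
import Relation.Binary.Construct.On as On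
open import Relation.Binary.Core using (Rel)
open import Relation.Binary.Definitions
  using (DecidableEquality; Irreflexive; Symmetric; _Respects₂_)
open import Relation.Binary.PropositionalEquality
  using (_≡_; _≢_; refl; sym; trans; cong; isMagma; module ≡-Reasoning)
import Relation.Binary.PropositionalEquality.Properties as ≡
open import Relation.Nullary.Decidable using (Dec; yes; no; map′; _×-dec_; from-yes)
open import Relation.Nullary.Negation using (¬_; contradiction)
open import Relation.Unary using (Pred; Decidable; Satisfiable; U; _∩_; _⊆_; _≐_)
open import Relation.Unary.Properties using (≐-refl; ≐-sym; ≐-trans)

------------------------------------------------------------------------
-- Cardinalities and strongly regular graphs

-- Vertex sets and point sets are setoids, since a point is a vector up to a
-- scalar and an ovoid is a set of points up to extensional equality.

HasSize : ∀ {c ℓ} → Setoid c ℓ → ℕ → Set (c ⊔ ℓ)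
HasSize S n = Inverse S (≡.setoid (Fin n))

module _ {c ℓ} (S : Setoid c ℓ) where
  open Setoid S using (Carrier; _≈_)

  subsetoid : ∀ {p} → Pred Carrier p → Setoid (c ⊔ p) ℓ
  subsetoid P = On.setoid S (proj₁ {B = P})

  record IsStronglyRegular {r} (_~_ : Rel Carrier r) (v k lam mu : ℕ)
         : Set (c ⊔ ℓ ⊔ r) where
    field
      respects     : _~_ Respects₂ _≈_
      irreflexive  : Irreflexive _≈_ _~_
      symmetric    : Symmetric _~_
      connected    : ∀ x y → Star (λ a b → a ≈ b ⊎ a ~ b) x y
      order        : HasSize S v
      regular      : ∀ x → HasSize (subsetoid (x ~_)) k
      adjacent     : ∀ x y → x ~ y →
                     HasSize (subsetoid ((x ~_) ∩ (y ~_))) lam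
      non-adjacent : ∀ x y → ¬ (x ≈ y) → ¬ (x ~ y) →
                     HasSize (subsetoid ((x ~_) ∩ (y ~_))) mu

------------------------------------------------------------------------
-- Discrete fields

record DiscreteField : Set₁ where
  infixl 7 _*_
  infixl 6 _+_
  infix  8 -_
  field
    Carrier           : Set
    _+_ _*_           : Carrier → Carrier → Carrier
    -_                : Carrier → Carrier
    0# 1#             : Carrier
    isCommutativeRing : IsCommutativeRing _≡_ _+_ _*_ -_ 0# 1#
    1≢0               : 1# ≢ 0#
    inverse           : ∀ x → x ≢ 0# → ∃ λ y → y * x ≡ 1#

  open IsCommutativeRing isCommutativeRing public
    using (_-_; *-assoc; *-identityˡ; zeroˡ)

  rawRing : RawRing 0ℓ 0ℓ
  rawRing = record
    { Carrier = Carrier ; _≈_ = _≡_ ; _+_ = _+_ ; _*_ = _*_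
    ; -_ = -_ ; 0# = 0# ; 1# = 1# }

------------------------------------------------------------------------
-- The projective space PG(d,F)

module PG (F : DiscreteField) where
  open DiscreteField F renaming (Carrier to K)

  Vect : ℕ → Set
  Vect n = Vec K n

  𝟎 : ∀ {n} → Vect n
  𝟎 = replicate _ 0#

  infixl 6 _⊕_
  infixr 7 _•_

  _⊕_ : ∀ {n} → Vect n → Vect n → Vect n
  _⊕_ = zipWith _+_

  _•_ : ∀ {n} → K → Vect n → Vect n
  c • x = map (c *_) x

  combination : ∀ {m n} → Vect m → Vec (Vect n) m → Vect n
  combination c g = foldr′ _⊕_ 𝟎 (zipWith _•_ c g)

  Independent : ∀ {m n} → Vec (Vect n) m → Set
  Independent g = ∀ c → combination c g ≡ 𝟎 → c ≡ 𝟎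

  infix 4 _∝_

  _∝_ : ∀ {n} → Vect n → Vect n → Set
  x ∝ y = ∃ λ c → x ≡ c • y

  record Point (d : ℕ) : Set where
    field
      vec     : Vect (suc d)
      nonzero : vec ≢ 𝟎

  open Point public

  private
    •-identity : ∀ {n} (x : Vect n) → 1# • x ≡ x
    •-identity x = trans (map-cong *-identityˡ x) (map-id x)

    •-assoc : ∀ {n} c d (x : Vect n) → (c * d) • x ≡ c • d • x
    •-assoc c d x = trans (map-cong (*-assoc c d) x) (map-∘ (c *_) (d *_) x)

    •-zero : ∀ {n} (x : Vect n) → 0# • x ≡ 𝟎
    •-zero x = trans (map-cong zeroˡ x) (map-const x 0#)

    ∝-refl : ∀ {n} {x : Vect n} → x ∝ x
    ∝-refl {x = x} = 1# , sym (•-identity x)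

    ∝-trans : ∀ {n} {x y z : Vect n} → x ∝ y → y ∝ z → x ∝ z
    ∝-trans {z = z} (c , refl) (d , refl) = c * d , sym (•-assoc c d z)

    ∝-sym : ∀ {n} {x y : Vect n} → x ≢ 𝟎 → x ∝ y → y ∝ x
    ∝-sym {y = y} x≢𝟎 (c , refl)
      with inverse c (λ { refl → x≢𝟎 (•-zero y) })
    ... | d , dc≡1 = d , sym (begin
      d • c • y    ≡⟨ •-assoc d c y ⟨
      (d * c) • y  ≡⟨ cong (_• y) dc≡1 ⟩
      1# • y       ≡⟨ •-identity y ⟩
      y            ∎)
      where open ≡-Reasoning

  points : ℕ → Setoid 0ℓ 0ℓ
  points d = record
    { Carrier       = Point d
    ; _≈_           = λ P Q → vec P ∝ vec Q
    ; isEquivalence = record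
      { refl  = ∝-refl
      ; sym   = λ {P} → ∝-sym (nonzero P)
      ; trans = ∝-trans
      }
    }

  infix 4 _≈ₚ_

  _≈ₚ_ : ∀ {d} → Rel (Point d) 0ℓ
  _≈ₚ_ {d} = Setoid._≈_ (points d)

  PointSet : ℕ → Set₁
  PointSet d = Pred (Point d) 0ℓ

  ∣_∣≡_ : ∀ {d} → PointSet d → ℕ → Set
  ∣ S ∣≡ n = HasSize (subsetoid (points _) S) n

  record Line (d : ℕ) : Set where
    field
      p q      : Point d
      distinct : ¬ (p ≈ₚ q)

  pointsOf : ∀ {d} → Line d → PointSet d
  pointsOf ℓ P = ∃ λ a → ∃ λ b → vec P ≡ a • vec p ⊕ b • vec q
    where open Line ℓ

  ----------------------------------------------------------------------
  -- Forms and polarities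

  record IsSesquilinear {n} (θ : K → K) (f : Vect n → Vect n → K) : Set where
    field
      +-left  : ∀ x y z → f (x ⊕ y) z ≡ f x z + f y z
      +-right : ∀ x y z → f x (y ⊕ z) ≡ f x y + f x z
      •-left  : ∀ c x y → f (c • x) y ≡ c * f x y
      •-right : ∀ c x y → f x (c • y) ≡ θ c * f x y

  IsBilinear : ∀ {n} → (Vect n → Vect n → K) → Set
  IsBilinear = IsSesquilinear id

  NonDegenerate : ∀ {n} → (Vect n → Vect n → K) → Set
  NonDegenerate f = ∀ x → (∀ y → f x y ≡ 0#) → x ≡ 𝟎

  -- The polarity of a reflexive form, as a map on subspaces (viewed as
  -- point sets).  A point P is passed to it as the singleton (P ≈ₚ_).
  polar : ∀ {d} → (Vect (suc d) → Vect (suc d) → K) → PointSet d → PointSet d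
  polar f S Q = ∀ P → S P → f (vec Q) (vec P) ≡ 0#

  TotallyIsotropic : ∀ {d} → (Vect (suc d) → Vect (suc d) → K) → Line d → Set
  TotallyIsotropic f ℓ = pointsOf ℓ ⊆ polar f (pointsOf ℓ)

  record SymplecticPolarity (d : ℕ) : Set where
    field
      form          : Vect (suc d) → Vect (suc d) → K
      bilinear      : IsBilinear form
      alternating   : ∀ x → form x x ≡ 0#
      nonDegenerate : NonDegenerate form

  ----------------------------------------------------------------------
  -- Semilinear involutions

  -- The collineation is an involution of the projective space, so the
  -- underlying vector map squares to the identity only up to scalars.
  record SemilinearInvolution (d : ℕ) : Set where
    field
      θ             : K → K
      automorphism  : IsRingIsomorphism rawRing rawRing θ
      map-vec       : Vect (suc d) → Vect (suc d)
      additive      : ∀ x y → map-vec (x ⊕ y) ≡ map-vec x ⊕ map-vec y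
      semilinear    : ∀ c x → map-vec (c • x) ≡ θ c • map-vec x
      injective     : ∀ x → map-vec x ≡ 𝟎 → x ≡ 𝟎

    apply : Point d → Point d
    apply P = record
      { vec     = map-vec (vec P)
      ; nonzero = nonzero P ∘ injective (vec P)
      }

    field
      involutive    : ∀ P → apply (apply P) ≈ₚ P
      nontrivial    : ∃ λ P → ¬ (apply P ≈ₚ P)

    Fixed : PointSet d
    Fixed P = apply P ≈ₚ P

  ----------------------------------------------------------------------
  -- Quadrics

  record QuadraticForm (d : ℕ) : Set where
    field
      form : Vect (suc d) → K

    polarForm : Vect (suc d) → Vect (suc d) → K
    polarForm x y = form (x ⊕ y) - form x - form y

    field
      homogeneous   : ∀ c x → form (c • x) ≡ (c * c) * form x
      polarBilinear : IsBilinear polarForm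

    quadric : PointSet d
    quadric P = form (vec P) ≡ 0#

  -- Q⁻(3,q): a non-singular quadric of PG(3,q) of Witt index one, i.e. one
  -- containing points but no lines.
  record IsElliptic (Q : QuadraticForm 3) : Set where
    open QuadraticForm Q
    field
      nonSingular : ∀ P → quadric P → ¬ (∀ y → polarForm (vec P) y ≡ 0#)
      hasPoint    : Satisfiable quadric
      hasNoLine   : ∀ ℓ → ¬ (pointsOf ℓ ⊆ quadric)

  Tangent : ∀ {d} → PointSet d → Line d → Set
  Tangent S ℓ = ∣ pointsOf ℓ ∩ S ∣≡ 1

------------------------------------------------------------------------
-- GF(2) and GF(4)

GF2 : DiscreteField
GF2 = record
  { isCommutativeRing = CommutativeRing.isCommutativeRing xor-∧-commutativeRing
  ; 1≢0               = λ ()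
  ; inverse           = λ { true _ → true , refl ; false x≢0 → contradiction refl x≢0 }
  }

-- ω² = ω + 1
data 𝔽₄ : Set where
  O I ω ω² : 𝔽₄

module GF4-Arithmetic where
  infixl 7 _*_
  infixl 6 _+_

  _+_ : 𝔽₄ → 𝔽₄ → 𝔽₄
  O  + y  = y
  I  + O  = I
  I  + I  = O
  I  + ω  = ω²
  I  + ω² = ω
  ω  + O  = ω
  ω  + I  = ω²
  ω  + ω  = O
  ω  + ω² = I
  ω² + O  = ω²
  ω² + I  = ω
  ω² + ω  = I
  ω² + ω² = O

  _*_ : 𝔽₄ → 𝔽₄ → 𝔽₄
  O  * y  = O
  I  * y  = y
  ω  * O  = O
  ω  * I  = ω
  ω  * ω  = ω²
  ω  * ω² = I
  ω² * O  = O
  ω² * I  = ω²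
  ω² * ω  = I
  ω² * ω² = ω

  _≟_ : DecidableEquality 𝔽₄
  O  ≟ O  = yes refl
  O  ≟ I  = no λ ()
  O  ≟ ω  = no λ ()
  O  ≟ ω² = no λ ()
  I  ≟ O  = no λ ()
  I  ≟ I  = yes refl
  I  ≟ ω  = no λ ()
  I  ≟ ω² = no λ ()
  ω  ≟ O  = no λ ()
  ω  ≟ I  = no λ ()
  ω  ≟ ω  = yes refl
  ω  ≟ ω² = no λ ()
  ω² ≟ O  = no λ ()
  ω² ≟ I  = no λ ()
  ω² ≟ ω  = no λ ()
  ω² ≟ ω² = yes refl

  all? : ∀ {p} {P : Pred 𝔽₄ p} → Decidable P → Dec (∀ x → P x)
  all? P? = map′
    (λ { (o , i , w , w²) → λ { O → o ; I → i ; ω → w ; ω² → w² } })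
    (λ f → f O , f I , f ω , f ω²)
    (P? O ×-dec P? I ×-dec P? ω ×-dec P? ω²)

  isCommutativeRing : IsCommutativeRing _≡_ _+_ _*_ id O I
  isCommutativeRing = record
    { isRing = record
      { +-isAbelianGroup = record
        { isGroup = record
          { isMonoid = record
            { isSemigroup = record
              { isMagma = isMagma _+_
              ; assoc   = from-yes (all? λ x → all? λ y → all? λ z →
                            ((x + y) + z) ≟ (x + (y + z)))
              }
            ; identity = (λ _ → refl) , from-yes (all? λ x → (x + O) ≟ x)
            }
          ; inverse = self-inverse , self-inverse
          ; ⁻¹-cong = id
          }
        ; comm = from-yes (all? λ x → all? λ y → (x + y) ≟ (y + x))
        }
      ; *-cong     = λ { refl refl → refl }
      ; *-assoc    = from-yes (all? λ x → all? λ y → all? λ z →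
                       ((x * y) * z) ≟ (x * (y * z)))
      ; *-identity = (λ _ → refl) , from-yes (all? λ x → (x * I) ≟ x)
      ; distrib    = from-yes (all? λ x → all? λ y → all? λ z →
                       (x * (y + z)) ≟ (x * y + x * z))
                   , from-yes (all? λ x → all? λ y → all? λ z →
                       ((y + z) * x) ≟ (y * x + z * x))
      }
    ; *-comm = from-yes (all? λ x → all? λ y → (x * y) ≟ (y * x))
    }
    where
    self-inverse : ∀ x → x + x ≡ O
    self-inverse = from-yes (all? λ x → (x + x) ≟ O)

  inverse : ∀ x → x ≢ O → ∃ λ y → y * x ≡ I
  inverse O  x≢0 = contradiction refl x≢0
  inverse I  _   = I , refl
  inverse ω  _   = ω² , refl
  inverse ω² _   = ω , refl

GF4 : DiscreteField
GF4 = record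
  { isCommutativeRing = GF4-Arithmetic.isCommutativeRing
  ; 1≢0               = λ ()
  ; inverse           = GF4-Arithmetic.inverse
  }

conj : 𝔽₄ → 𝔽₄
conj x = x GF4-Arithmetic.* x

ι : Bool → 𝔽₄
ι false = O
ι true  = I

module P₂ = PG GF2
module P₄ = PG GF4

------------------------------------------------------------------------
-- The Hermitian surface and its symplectic subquadrangles

-- H(3,4) is determined by its polarity, through which alone it enters the
-- definition of a symplectic subquadrangle.
record UnitaryPolarity (d : ℕ) : Set where
  field
    form          : P₄.Vect (suc d) → P₄.Vect (suc d) → 𝔽₄
    sesquilinear  : P₄.IsSesquilinear conj form
    hermitian     : ∀ x y → form y x ≡ conj (form x y)
    nonDegenerate : P₄.NonDegenerate form

-- The points of PG(3,4) whose coordinates with respect to some basis can be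
-- chosen in GF(2).  Lines of Σ are handled as lines of PG(3,2) via `embed`.
record BaerSubgeometry : Set where
  field
    basis       : Vec (P₄.Vect 4) 4
    independent : P₄.Independent basis

  embed : P₂.Vect 4 → P₄.Vect 4
  embed u = P₄.combination (map ι u) basis

  image : P₂.PointSet 3 → P₄.PointSet 3
  image S P = ∃ λ (u : P₂.Point 3) → S u × P₄.vec P P₄.∝ embed (P₂.vec u)

  pointSet : P₄.PointSet 3
  pointSet = image U

record SymplecticSubquadrangle (⊥ : UnitaryPolarity 3) : Set where
  field
    baer     : BaerSubgeometry
    polarity : P₂.SymplecticPolarity 3
    ⊥̃        : P₄.SymplecticPolarity 3
    σ        : P₄.SemilinearInvolution 3

  open BaerSubgeometry baer public
  private
    module h = UnitaryPolarity ⊥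
    module a = P₂.SymplecticPolarity polarity
    module b = P₄.SymplecticPolarity ⊥̃
    module s = P₄.SemilinearInvolution σ

  field
    extends  : ∀ (u v : P₂.Point 3) →
               a.form (P₂.vec u) (P₂.vec v) ≡ false ⇔
               b.form (embed (P₂.vec u)) (embed (P₂.vec v)) ≡ O
    ⊥̃⊥≐σ     : ∀ P → P₄.polar h.form (P₄.polar b.form (P P₄.≈ₚ_))
                     ≐ (s.apply P P₄.≈ₚ_)
    ⊥⊥̃≐σ     : ∀ P → P₄.polar b.form (P₄.polar h.form (P P₄.≈ₚ_))
                     ≐ (s.apply P P₄.≈ₚ_)
    fixed    : s.Fixed ≐ pointSet

  IsGenerator : P₂.Line 3 → Set
  IsGenerator = P₂.TotallyIsotropic a.form

------------------------------------------------------------------------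
-- The graph on elliptic ovoids

record EllipticOvoid {⊥} (W : SymplecticSubquadrangle ⊥) : Set where
  open SymplecticSubquadrangle W using (image; IsGenerator)
  field
    quadraticForm : P₂.QuadraticForm 3
    isElliptic    : P₂.IsElliptic quadraticForm

  quadric : P₂.PointSet 3
  quadric = P₂.QuadraticForm.quadric quadraticForm

  field
    tangents      : ∀ ℓ → P₂.Tangent quadric ℓ ⇔ IsGenerator ℓ

  ovoid : P₄.PointSet 3
  ovoid = image quadric

Vertex : UnitaryPolarity 3 → Set
Vertex ⊥ = Σ (SymplecticSubquadrangle ⊥) EllipticOvoid

module _ {⊥ : UnitaryPolarity 3} where

  ovoidOf subquadrangleOf : Vertex ⊥ → P₄.PointSet 3
  ovoidOf         (_ , 𝒪) = EllipticOvoid.ovoid 𝒪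
  subquadrangleOf (W , _) = SymplecticSubquadrangle.pointSet W

-- Vertices are equal when their ovoids are the same set of points: the
-- subquadrangle, the forms and the basis that a vertex carries do not count.
vertices : UnitaryPolarity 3 → Setoid 0ℓ 0ℓ
vertices ⊥ = record
  { Carrier       = Vertex ⊥
  ; _≈_           = λ x y → ovoidOf x ≐ ovoidOf y
  ; isEquivalence = record { refl = ≐-refl ; sym = ≐-sym ; trans = ≐-trans }
  }

Γ : (⊥ : UnitaryPolarity 3) → Rel (Vertex ⊥) 0ℓ
Γ ⊥ x y = (P₄.∣ ovoidOf x ∩ ovoidOf y ∣≡ 1)
        × (P₄.∣ subquadrangleOf x ∩ subquadrangleOf y ∣≡ 6)

{-# OPTIONS --safe #-}
-- Scale the five points of an elliptic ovoid to vectors y₁, …, y₅ with sum zero that span Σ over GF(2).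
-- Two points of Σ are perpendicular for ⊥ exactly when they are for the symplectic polarity of 𝒲; no
-- two points of the ovoid are, but yᵢ + yⱼ is perpendicular to yₖ, so all products
-- h(yᵢ, yⱼ) with i ≠ j equal 1. Conversely every such "pentad" of isotropic vectors arises, 𝒲 being the
-- set of the points yᵢ and yᵢ + yⱼ, and two pentads give the same ovoid exactly when they differ by a
-- scalar and a permutation. Four vectors of a pentad form a basis in which h has matrix J − I. Hence, in
-- the coordinates given by the pentad of an arbitrary vertex x, the vertices are the pentads of one fixed
-- form, x being the standard one. These are enumerated (there are 216), and the numbers 40, 4 and 8 are
-- counted from the standard pentad alone. A pentad exists because h has an orthonormal basis.
module Submission where

open import Algebra.Morphism.Structures using (IsRingIsomorphism)
open import Data.Bool.Base using (Bool; true; false; _∨_; _∧_; _xor_; T)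
import Data.Bool.Properties as Bool
open import Data.Fin.Base as Fin using (Fin)
open import Data.Fin.Permutation using (↔⇒≡)
import Data.Fin.Properties as Fin
open import Data.List.Base as List using (List; []; _∷_; _++_; filter; length; lookup; cartesianProductWith)
open import Data.List.Membership.Propositional using (_∈_; find; lose)
open import Data.List.Membership.Propositional.Properties
import Data.List.Properties as List
import Data.List.Relation.Binary.Permutation.Propositional as Perm
open import Data.List.Relation.Binary.Permutation.Propositional using (_↭_; ↭-sym; ↭-refl; ↭-trans; ↭-reflexive)
import Data.List.Relation.Binary.Permutation.Propositional.Properties as Perm
open import Data.List.Relation.Binary.Subset.Propositional using (_⊆_)
import Data.List.Relation.Binary.Subset.Propositional.Properties as Subset
open import Data.List.Relation.Unary.All as All using (All; []; _∷_)
import Data.List.Relation.Unary.All.Properties as All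
open import Data.List.Relation.Unary.AllPairs as AllPairs using (AllPairs; []; _∷_; allPairs?)
import Data.List.Relation.Unary.AllPairs.Properties as AllPairs
open import Data.List.Relation.Unary.Any as Any using (Any; here; there; index)
import Data.List.Relation.Unary.Any.Properties as Any
open import Data.List.Relation.Unary.Unique.Propositional using (Unique)
import Data.List.Relation.Unary.Unique.Propositional.Properties as Unique
open import Data.Nat.Base as ℕ using (ℕ; zero; suc)
open import Data.Nat.DivMod using (_/_; _%_)
import Data.Nat.Properties as ℕ
open import Data.Product.Base using (Σ; ∃; ∃₂; _×_; _,_; proj₁; proj₂; swap)
open import Data.Product.Properties using () renaming (≡-dec to ×-≡-dec)
open import Data.Sum.Base as Sum using (_⊎_; inj₁; inj₂; [_,_]′)
open import Data.Unit.Base using (⊤; tt)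
open import Data.Vec.Base as Vec using (Vec; []; _∷_)
import Data.Vec.Properties as Vec
open import Function.Base using (id; _∘_)
open import Function.Bundles using (Inverse; _⇔_; mk⇔; Equivalence)
import Function.Construct.Composition as Composition
import Function.Construct.Symmetry as Symmetry
open import Function.Definitions using (Injective)
open import Relation.Binary.Bundles using (Setoid)
open import Relation.Binary.Construct.Closure.ReflexiveTransitive using (Star; ε; _◅_)
open import Relation.Binary.Core using (Rel)
open import Relation.Binary.Definitions using (DecidableEquality; Symmetric)
open import Relation.Binary.PropositionalEquality hiding (J)
open import Relation.Nullary.Decidable
open import Relation.Nullary.Negation using (¬_; contradiction)
open import Relation.Unary using (Pred; Decidable; _∩_; _≐_)

open import Defs

-- Sizes of setoids and enumerations of vectors

-- Counting from one vertex calls for transitivity of the unitary group on the vertices. It is not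
-- established as such: the counting is parametrised by a base vertex, and in the frame of its own
-- pentad every vertex has the coordinates of `pentad₀`. A statement about an arbitrary vertex
-- thereby becomes a statement about one closed term. The obstacle is that the type checker has to
-- evaluate this term. An abstract `h` does not compute, so it is replaced by the explicit form
-- `h₀`; points become natural numbers, an ovoid and its subquadrangle become bit lists over the 85
-- points, and opaque definitions keep the evaluation of the table inside `check`. Equality of
-- vertices sees only ovoids while adjacency also sees subquadrangles; that an ovoid determines its
-- subquadrangle is read off from the table. For the converse, the involution belonging to a pentad
-- is conjugation of coordinates in its frame, and composing the second argument of `h` with it
-- gives the symplectic form. Both products of the two polarities are then this involution, since a
-- hyperplane has only one pole.

module _ {a} {A : Set a} where

  lookup-injective : ∀ {xs : List A} → Unique xs → Injective _≡_ _≡_ (lookup xs)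
  lookup-injective {_ ∷ xs} (x∉xs ∷ _) {Fin.zero}  {Fin.zero}  _  = refl
  lookup-injective {_ ∷ xs} (x∉xs ∷ _) {Fin.zero}  {Fin.suc j} eq =
    contradiction eq (All.lookup x∉xs (∈-lookup j))
  lookup-injective {_ ∷ xs} (x∉xs ∷ _) {Fin.suc i} {Fin.zero}  eq =
    contradiction (sym eq) (All.lookup x∉xs (∈-lookup i))
  lookup-injective {_ ∷ xs} (_ ∷ u)    {Fin.suc i} {Fin.suc j} eq =
    cong Fin.suc (lookup-injective u eq)

  -- Pigeonhole: sending a position of `xs` to the position of its entry in `ys` is injective.
  Unique-⊆-length : ∀ {xs ys : List A} → Unique xs → xs ⊆ ys → length xs ℕ.≤ length ys
  Unique-⊆-length {xs} {ys} u xs⊆ys = Fin.injective⇒≤ {f = λ i → index (member i)} λ {i} {j} eq →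
    lookup-injective u (begin
      lookup xs i                   ≡⟨ Any.lookup-index (member i) ⟩
      lookup ys (index (member i))  ≡⟨ cong (lookup ys) eq ⟩
      lookup ys (index (member j))  ≡⟨ Any.lookup-index (member j) ⟨
      lookup xs j                   ∎)
    where
    open ≡-Reasoning
    member : ∀ i → lookup xs i ∈ ys
    member i = xs⊆ys (∈-lookup i)

module _ {c ℓ} {S : Setoid c ℓ} where
  open Setoid S using (Carrier; _≈_)

  size-unique : ∀ {m n} → HasSize S m → HasSize S n → m ≡ n
  size-unique f g = ↔⇒≡ (Composition.inverse (Symmetry.inverse f) g)

  size-U : ∀ {n} → HasSize (subsetoid S (λ _ → ⊤)) n → HasSize S n
  size-U f = record
    { to = λ x → to (x , _) ; from = proj₁ ∘ from
    ; to-cong = to-cong ; from-cong = from-cong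
    ; inverse = inverseˡ , inverseʳ }
    where open Inverse f

  module _ {p q} {P : Pred Carrier p} {Q : Pred Carrier q} where

    size-≐ : ∀ {n} → P ≐ Q → HasSize (subsetoid S P) n → HasSize (subsetoid S Q) n
    size-≐ (P⊆Q , Q⊆P) f = record
      { to = λ (x , Qx) → to (x , Q⊆P Qx) ; from = λ i → let x , Px = from i in x , P⊆Q Px
      ; to-cong = to-cong ; from-cong = from-cong
      ; inverse = inverseˡ , inverseʳ }
      where open Inverse f

  module _ {a} {A : Set a} {code : Carrier → A}
    (code-cong      : ∀ {x y} → x ≈ y → code x ≡ code y)
    (code-injective : ∀ {x y} → code x ≡ code y → x ≈ y)
    where

    -- A code that identifies exactly the equivalent elements reduces counting in a setoid to a
    -- repetition-free list of codes. It serves for points, coded by numbers, and for vertices,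
    -- coded by rows of the table.
    size-coded : ∀ {p} {P : Pred Carrier p} {xs : List A} → Unique xs →
                 (∀ {x} → P x → code x ∈ xs) →
                 (∀ {a} → a ∈ xs → ∃ λ x → P x × code x ≡ a) →
                 HasSize (subsetoid S P) (length xs)
    size-coded {P = P} {xs} unique encode decode = record
      { to        = to
      ; from      = from
      ; to-cong   = λ {x} {y} → to-cong {x} {y}
      ; from-cong = λ { refl → Setoid.refl S }
      ; inverse   = (λ {i} {x} x≈ → lookup-injective unique (trans (to-code x) (trans (code-cong x≈) (from-code i))))
                  , (λ { {x} refl → code-injective (trans (from-code (to x)) (to-code x)) })
      }
      where
      to : Σ Carrier P → Fin (length xs)
      to (x , Px) = index (encode Px)
      from : Fin (length xs) → Σ Carrier P
      from i = let x , Px , _ = decode (∈-lookup {xs = xs} i) in x , Px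
      to-code : ∀ x → lookup xs (to x) ≡ code (proj₁ x)
      to-code (_ , Px) = sym (Any.lookup-index (encode Px))
      from-code : ∀ i → code (proj₁ (from i)) ≡ lookup xs i
      from-code i = proj₂ (proj₂ (decode (∈-lookup {xs = xs} i)))
      to-cong : ∀ {x y} → proj₁ x ≈ proj₁ y → to x ≡ to y
      to-cong {x} {y} x≈y = lookup-injective unique
        (trans (to-code x) (trans (code-cong x≈y) (sym (to-code y))))

module Vectors {A : Set} {elements : List A} (unique : Unique elements) (complete : ∀ x → x ∈ elements) where

  vectors : ∀ n → List (Vec A n)
  vectors zero    = [] ∷ []
  vectors (suc n) = cartesianProductWith _∷_ elements (vectors n)

  ∈-vectors : ∀ {n} (v : Vec A n) → v ∈ vectors n
  ∈-vectors []      = here refl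
  ∈-vectors (x ∷ v) = ∈-cartesianProductWith⁺ _∷_ (complete x) (∈-vectors v)

  vectors-unique : ∀ n → Unique (vectors n)
  vectors-unique zero    = [] ∷ []
  vectors-unique (suc n) =
    Unique.cartesianProductWith⁺ _∷_ Vec.∷-injective unique (vectors-unique n)

  module _ {n p} {P : Pred (Vec A n) p} (P? : Decidable P) where

    every? : Dec (∀ v → P v)
    every? = map′ (λ all v → All.lookup all (∈-vectors v)) (λ f → All.tabulate λ {v} _ → f v)
      (All.all? P? (vectors n))

    some? : Dec (∃ P)
    some? = map′ Any.satisfied (λ (v , Pv) → lose (∈-vectors v) Pv) (Any.any? P? (vectors n))

  module _ {n} (_≟_ : DecidableEquality (Vec A n)) {f : Vec A n → Vec A n} (injective : Injective _≡_ _≡_ f) where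

    open import Data.List.Membership.DecPropositional _≟_ using (_∈?_)

    -- A missed `y` put in front of the image would give a repetition-free list longer than the list
    -- of all vectors.
    injective⇒surjective : ∀ y → ∃ λ x → f x ≡ y
    injective⇒surjective y = image (decidable-stable (y ∈? List.map f (vectors n)) λ y∉ →
      ℕ.<-irrefl refl (subst (ℕ._< length (vectors n)) (List.length-map f (vectors n))
        (Unique-⊆-length (All.¬Any⇒All¬ _ y∉ ∷ Unique.map⁺ injective (vectors-unique n)) (λ {v} _ → ∈-vectors v))))
      where
      image : y ∈ List.map f (vectors n) → ∃ λ x → f x ≡ y
      image y∈ = let x , _ , y≡fx = ∈-map⁻ f y∈ in x , sym y≡fx

  injective⇒≤ : ∀ {m n} {f : Vec A m → Vec A n} → Injective _≡_ _≡_ f → length (vectors m) ℕ.≤ length (vectors n)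
  injective⇒≤ {m} {n} {f} injective = subst (ℕ._≤ length (vectors n)) (List.length-map f (vectors m))
    (Unique-⊆-length (Unique.map⁺ injective (vectors-unique m)) λ {v} _ → ∈-vectors v)

-- Linear algebra over GF(4)

open GF4-Arithmetic using (_+_; _*_; all?) renaming (_≟_ to _≟₄_)
open P₄ using (Vect; Point; vec; nonzero; PointSet; _⊕_; _•_; 𝟎; combination; _∝_; polar; _≈ₚ_)

scalars : List 𝔽₄
scalars = O ∷ I ∷ ω ∷ ω² ∷ []

∈-scalars : ∀ c → c ∈ scalars
∈-scalars O  = here refl
∈-scalars I  = there (here refl)
∈-scalars ω  = there (there (here refl))
∈-scalars ω² = there (there (there (here refl)))

module V₄ = Vectors (from-yes (allPairs? (λ x y → ¬? (x ≟₄ y)) scalars)) ∈-scalars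

_≟ᵥ_ : ∀ {n} → DecidableEquality (Vect n)
_≟ᵥ_ = Vec.≡-dec _≟₄_

module GF4-Properties where

  +-self : ∀ x → x + x ≡ O
  +-self = from-yes (all? λ x → (x + x) ≟₄ O)

  +-identityʳ : ∀ x → x + O ≡ x
  +-identityʳ = from-yes (all? λ x → (x + O) ≟₄ x)

  +-zero : ∀ x y → x + y ≡ O → x ≡ y
  +-zero = from-yes (all? λ x → all? λ y → ((x + y) ≟₄ O) →-dec (x ≟₄ y))

  +-interchange : ∀ x y z t → (x + y) + (z + t) ≡ (x + z) + (y + t)
  +-interchange = from-yes (all? λ x → all? λ y → all? λ z → all? λ t →
    ((x + y) + (z + t)) ≟₄ ((x + z) + (y + t)))

  *-assoc : ∀ x y z → (x * y) * z ≡ x * (y * z)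
  *-assoc = from-yes (all? λ x → all? λ y → all? λ z → ((x * y) * z) ≟₄ (x * (y * z)))

  *-distribˡ : ∀ x y z → x * (y + z) ≡ x * y + x * z
  *-distribˡ = from-yes (all? λ x → all? λ y → all? λ z → (x * (y + z)) ≟₄ (x * y + x * z))

  *-distribʳ : ∀ x y z → (y + z) * x ≡ y * x + z * x
  *-distribʳ = from-yes (all? λ x → all? λ y → all? λ z → ((y + z) * x) ≟₄ (y * x + z * x))

  *-zeroʳ : ∀ x → x * O ≡ O
  *-zeroʳ = from-yes (all? λ x → (x * O) ≟₄ O)

  *-identityʳ : ∀ x → x * I ≡ x
  *-identityʳ = from-yes (all? λ x → (x * I) ≟₄ x)

  *-rotate : ∀ x y z → (x * y) * z ≡ (z * y) * x
  *-rotate = from-yes (all? λ x → all? λ y → all? λ z → ((x * y) * z) ≟₄ ((z * y) * x))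

  conj-+ : ∀ x y → conj (x + y) ≡ conj x + conj y
  conj-+ = from-yes (all? λ x → all? λ y → conj (x + y) ≟₄ (conj x + conj y))

  conj-* : ∀ x y → conj (x * y) ≡ conj x * conj y
  conj-* = from-yes (all? λ x → all? λ y → conj (x * y) ≟₄ (conj x * conj y))

  conj-involutive : ∀ x → conj (conj x) ≡ x
  conj-involutive = from-yes (all? λ x → conj (conj x) ≟₄ x)

module _ where
  open GF4-Properties

  ⊕-interchange : ∀ {n} (x y z t : Vect n) → (x ⊕ y) ⊕ (z ⊕ t) ≡ (x ⊕ z) ⊕ (y ⊕ t)
  ⊕-interchange []      []      []      []      = refl
  ⊕-interchange (a ∷ x) (b ∷ y) (c ∷ z) (d ∷ t) = cong₂ _∷_ (+-interchange a b c d) (⊕-interchange x y z t)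

  ⊕-comm : ∀ {n} (x y : Vect n) → x ⊕ y ≡ y ⊕ x
  ⊕-comm = Vec.zipWith-comm (from-yes (all? λ x → all? λ y → (x + y) ≟₄ (y + x)))

  ⊕-assoc : ∀ {n} (x y z : Vect n) → (x ⊕ y) ⊕ z ≡ x ⊕ (y ⊕ z)
  ⊕-assoc = Vec.zipWith-assoc (from-yes (all? λ x → all? λ y → all? λ z → ((x + y) + z) ≟₄ (x + (y + z))))

  ⊕-identityˡ : ∀ {n} (x : Vect n) → 𝟎 ⊕ x ≡ x
  ⊕-identityˡ = Vec.zipWith-identityˡ (λ _ → refl)

  ⊕-identityʳ : ∀ {n} (x : Vect n) → x ⊕ 𝟎 ≡ x
  ⊕-identityʳ = Vec.zipWith-identityʳ +-identityʳ

  ⊕-self : ∀ {n} (x : Vect n) → x ⊕ x ≡ 𝟎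
  ⊕-self []      = refl
  ⊕-self (a ∷ x) = cong₂ _∷_ (+-self a) (⊕-self x)

  ⊕-zero : ∀ {n} (x y : Vect n) → x ⊕ y ≡ 𝟎 → x ≡ y
  ⊕-zero []      []      _  = refl
  ⊕-zero (a ∷ x) (b ∷ y) eq = cong₂ _∷_ (+-zero a b (Vec.∷-injectiveˡ eq)) (⊕-zero x y (Vec.∷-injectiveʳ eq))

  •-identity : ∀ {n} (x : Vect n) → I • x ≡ x
  •-identity = Vec.map-id

  •-zeroˡ : ∀ {n} (x : Vect n) → O • x ≡ 𝟎
  •-zeroˡ x = Vec.map-const x O

  •-zeroʳ : ∀ {n} c → c • 𝟎 {n} ≡ 𝟎
  •-zeroʳ {n} c = trans (Vec.map-replicate (c *_) O n) (cong (Vec.replicate n) (*-zeroʳ c))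

  •-assoc : ∀ {n} a b (x : Vect n) → (a * b) • x ≡ a • b • x
  •-assoc a b x = trans (Vec.map-cong (*-assoc a b) x) (Vec.map-∘ (a *_) (b *_) x)

  •-distribˡ : ∀ {n} a (x y : Vect n) → a • (x ⊕ y) ≡ a • x ⊕ a • y
  •-distribˡ a []      []      = refl
  •-distribˡ a (b ∷ x) (c ∷ y) = cong₂ _∷_ (*-distribˡ a b c) (•-distribˡ a x y)

  •-distribʳ : ∀ {n} a b (x : Vect n) → (a + b) • x ≡ a • x ⊕ b • x
  •-distribʳ a b []      = refl
  •-distribʳ a b (c ∷ x) = cong₂ _∷_ (*-distribʳ c a b) (•-distribʳ a b x)

  combination-⊕ : ∀ {m n} (c d : Vect m) (g : Vec (Vect n) m) →
                  combination (c ⊕ d) g ≡ combination c g ⊕ combination d g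
  combination-⊕ []      []      []      = sym (⊕-identityˡ 𝟎)
  combination-⊕ (a ∷ c) (b ∷ d) (x ∷ g) = begin
    (a + b) • x ⊕ combination (c ⊕ d) g                       ≡⟨ cong₂ _⊕_ (•-distribʳ a b x) (combination-⊕ c d g) ⟩
    (a • x ⊕ b • x) ⊕ (combination c g ⊕ combination d g)     ≡⟨ ⊕-interchange (a • x) (b • x) _ _ ⟩
    (a • x ⊕ combination c g) ⊕ (b • x ⊕ combination d g)     ∎
    where open ≡-Reasoning

  combination-• : ∀ {m n} a (c : Vect m) (g : Vec (Vect n) m) →
                  combination (a • c) g ≡ a • combination c g
  combination-• a []      []      = sym (•-zeroʳ a)
  combination-• a (b ∷ c) (x ∷ g) =
    trans (cong₂ _⊕_ (•-assoc a b x) (combination-• a c g)) (sym (•-distribˡ a (b • x) (combination c g)))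

dot : ∀ {n} → Vect n → Vect n → 𝔽₄
dot x y = Vec.foldr′ _+_ O (Vec.zipWith _*_ x y)

conjᵥ : ∀ {n} → Vect n → Vect n
conjᵥ = Vec.map conj

conjᵥ-involutive : ∀ {n} (x : Vect n) → conjᵥ (conjᵥ x) ≡ x
conjᵥ-involutive []      = refl
conjᵥ-involutive (a ∷ x) = cong₂ _∷_ (GF4-Properties.conj-involutive a) (conjᵥ-involutive x)

conjᵥ-⊕ : ∀ {n} (x y : Vect n) → conjᵥ (x ⊕ y) ≡ conjᵥ x ⊕ conjᵥ y
conjᵥ-⊕ []      []      = refl
conjᵥ-⊕ (a ∷ x) (b ∷ y) = cong₂ _∷_ (GF4-Properties.conj-+ a b) (conjᵥ-⊕ x y)

conjᵥ-• : ∀ {n} a (x : Vect n) → conjᵥ (a • x) ≡ conj a • conjᵥ x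
conjᵥ-• a []      = refl
conjᵥ-• a (b ∷ x) = cong₂ _∷_ (GF4-Properties.conj-* a b) (conjᵥ-• a x)

module Sesquilinear {n θ} {f : Vect n → Vect n → 𝔽₄} (sesquilinear : P₄.IsSesquilinear θ f) where
  open P₄.IsSesquilinear sesquilinear public

  zeroˡ : ∀ y → f 𝟎 y ≡ O
  zeroˡ y = trans (cong (λ x → f x y) (sym (•-zeroˡ 𝟎))) (•-left O 𝟎 y)

  zeroʳ : ∀ x → f x 𝟎 ≡ O
  zeroʳ x = begin
    f x 𝟎            ≡⟨ cong (f x) (sym (⊕-self 𝟎)) ⟩
    f x (𝟎 ⊕ 𝟎)      ≡⟨ +-right x 𝟎 𝟎 ⟩
    f x 𝟎 + f x 𝟎    ≡⟨ GF4-Properties.+-self (f x 𝟎) ⟩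
    O                ∎
    where open ≡-Reasoning

  combinationˡ : ∀ {m} (c : Vect m) g y → f (combination c g) y ≡ dot c (Vec.map (λ x → f x y) g)
  combinationˡ []      []      y = zeroˡ y
  combinationˡ (a ∷ c) (x ∷ g) y =
    trans (+-left (a • x) (combination c g) y) (cong₂ _+_ (•-left a x y) (combinationˡ c g y))

  combinationʳ : ∀ {m} (c : Vect m) g x → f x (combination c g) ≡ dot (Vec.map θ c) (Vec.map (f x) g)
  combinationʳ []      []      x = zeroʳ x
  combinationʳ (a ∷ c) (y ∷ g) x =
    trans (+-right x (a • y) (combination c g)) (cong₂ _+_ (•-right a x y) (combinationʳ c g x))

-- Polarities and pentads

pattern ⟦_,_,_,_⟧ a b c d = a ∷ b ∷ c ∷ d ∷ []

module _ {θ} {f : Vect 4 → Vect 4 → 𝔽₄} (sesquilinear : P₄.IsSesquilinear θ f)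
  (θ-* : ∀ a b → θ (a * b) ≡ θ a * θ b) (θ-symmetric : ∀ x y → f y x ≡ θ (f x y))
  (nonDegenerate : P₄.NonDegenerate f) where

  open Sesquilinear sesquilinear

  private
    perp-sym : ∀ x y → f x y ≡ O → f y x ≡ O
    perp-sym x y fxy≡O = begin
      f y x        ≡⟨ θ-symmetric x y ⟩
      θ (f x y)    ≡⟨ cong θ (trans fxy≡O (sym (zeroʳ x))) ⟩
      θ (f x 𝟎)    ≡⟨ θ-symmetric x 𝟎 ⟨
      f 𝟎 x        ≡⟨ zeroˡ x ⟩
      O            ∎
      where open ≡-Reasoning

    not-perp : ∀ x → x ≢ 𝟎 → ∃ λ y → f y x ≢ O
    not-perp x x≢𝟎 = decidable-stable (V₄.some? λ y → ¬? (f y x ≟₄ O)) λ none →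
      x≢𝟎 (nonDegenerate x λ y → perp-sym y x
        (decidable-stable (f y x ≟₄ O) λ fyx≢O → none (y , fyx≢O)))

  -- `T` is the hyperplane perpendicular to `S`. Each x can be moved into it by a multiple of a
  -- fixed y not perpendicular to `S`; hence for Q polar to `T` the functional f(Q, -) is a multiple
  -- of f(S, -), and non-degeneracy makes Q the same multiple of `S`. The general `θ` covers both
  -- polarities: `conj` for ⊥, the identity for ⊥̃.
  polar-of-hyperplane : (S : Point 3) (T : PointSet 3) →
    (∀ R → T R → f (vec R) (vec S) ≡ O) → (∀ R → f (vec R) (vec S) ≡ O → T R) →
    polar f T ≐ (S ≈ₚ_)
  polar-of-hyperplane S T T⇒⊥S ⊥S⇒T = (λ {Q} → to Q) , λ {Q} → from Q
    where
    open ≡-Reasoning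

    to : ∀ Q → polar f T Q → S ≈ₚ Q
    to Q Q⊥T with y , fyS≢O ← not-perp (vec S) (nonzero S)
      with a , afyS≡I ← GF4-Arithmetic.inverse (f y (vec S)) fyS≢O =
      Setoid.sym (P₄.points 3) {Q} {S}
        (k , ⊕-zero (vec Q) (k • vec S) (nonDegenerate _ λ x → begin
          f (vec Q ⊕ k • vec S) x                        ≡⟨ +-left (vec Q) (k • vec S) x ⟩
          f (vec Q) x + f (k • vec S) x                  ≡⟨ cong₂ _+_ (fQ x) (•-left k (vec S) x) ⟩
          k * f (vec S) x + k * f (vec S) x              ≡⟨ GF4-Properties.+-self (k * f (vec S) x) ⟩
          O                                              ∎))
      where
      k : 𝔽₄
      k = f (vec Q) y * θ a

      Q⊥ : ∀ r → f r (vec S) ≡ O → f (vec Q) r ≡ O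
      -- The zero vector is not a point, so `Q⊥T` cannot be applied to it.
      Q⊥ r frS≡O with r ≟ᵥ 𝟎
      ... | yes refl = zeroʳ (vec Q)
      ... | no  r≢𝟎  = Q⊥T R (⊥S⇒T R frS≡O)
        where
        R : Point 3
        R = record { vec = r ; nonzero = r≢𝟎 }

      projected : ∀ x → f (x ⊕ (f x (vec S) * a) • y) (vec S) ≡ O
      projected x = begin
        f (x ⊕ (f x (vec S) * a) • y) (vec S)                ≡⟨ +-left x ((f x (vec S) * a) • y) (vec S) ⟩
        f x (vec S) + f ((f x (vec S) * a) • y) (vec S)      ≡⟨ cong (f x (vec S) +_) (•-left (f x (vec S) * a) y (vec S)) ⟩
        f x (vec S) + (f x (vec S) * a) * f y (vec S)        ≡⟨ cong (f x (vec S) +_) (GF4-Properties.*-assoc (f x (vec S)) a (f y (vec S))) ⟩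
        f x (vec S) + f x (vec S) * (a * f y (vec S))        ≡⟨ cong (λ b → f x (vec S) + f x (vec S) * b) afyS≡I ⟩
        f x (vec S) + f x (vec S) * I                        ≡⟨ cong (f x (vec S) +_) (GF4-Properties.*-identityʳ (f x (vec S))) ⟩
        f x (vec S) + f x (vec S)                            ≡⟨ GF4-Properties.+-self (f x (vec S)) ⟩
        O                                                    ∎

      fQ : ∀ x → f (vec Q) x ≡ k * f (vec S) x
      fQ x = GF4-Properties.+-zero _ _ (begin
        f (vec Q) x + k * f (vec S) x                            ≡⟨ cong (λ b → f (vec Q) x + k * b) (θ-symmetric x (vec S)) ⟩
        f (vec Q) x + (f (vec Q) y * θ a) * θ (f x (vec S))      ≡⟨ cong (f (vec Q) x +_) (GF4-Properties.*-rotate (f (vec Q) y) (θ a) (θ (f x (vec S)))) ⟩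
        f (vec Q) x + (θ (f x (vec S)) * θ a) * f (vec Q) y      ≡⟨ cong (λ b → f (vec Q) x + b * f (vec Q) y) (θ-* (f x (vec S)) a) ⟨
        f (vec Q) x + θ (f x (vec S) * a) * f (vec Q) y          ≡⟨ cong (f (vec Q) x +_) (•-right (f x (vec S) * a) (vec Q) y) ⟨
        f (vec Q) x + f (vec Q) ((f x (vec S) * a) • y)          ≡⟨ +-right (vec Q) x ((f x (vec S) * a) • y) ⟨
        f (vec Q) (x ⊕ (f x (vec S) * a) • y)                    ≡⟨ Q⊥ _ (projected x) ⟩
        O                                                        ∎)

    from : ∀ Q → S ≈ₚ Q → polar f T Q
    from Q S≈Q R TR with k , Q≡ ← Setoid.sym (P₄.points 3) {S} {Q} S≈Q = begin
      f (vec Q) (vec R)        ≡⟨ cong (λ q → f q (vec R)) Q≡ ⟩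
      f (k • vec S) (vec R)    ≡⟨ •-left k (vec S) (vec R) ⟩
      k * f (vec S) (vec R)    ≡⟨ cong (k *_) (perp-sym (vec R) (vec S) (T⇒⊥S R TR)) ⟩
      k * O                    ≡⟨ GF4-Properties.*-zeroʳ k ⟩
      O                        ∎

𝟏 : Vect 4
𝟏 = ⟦ I , I , I , I ⟧

-- The form with matrix J − I, where J is the all-ones matrix, in the shape
-- h₀ c d = Σᵢ conj dᵢ · (Σ_{j ≠ i} cⱼ); written out since it is evaluated often.
others : Vect 4 → Vect 4
others ⟦ a , b , c , d ⟧ = ⟦ b + c + d , a + c + d , a + b + d , a + b + c ⟧

h₀ : Vect 4 → Vect 4 → 𝔽₄
h₀ ⟦ a , b , c , d ⟧ ⟦ a′ , b′ , c′ , d′ ⟧ =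
  conj a′ * (b + c + d) + (conj b′ * (a + c + d) + (conj c′ * (a + b + d) + (conj d′ * (a + b + c) + O)))

h₀-dot : ∀ c d → h₀ c d ≡ dot (conjᵥ d) (others c)
h₀-dot ⟦ _ , _ , _ , _ ⟧ ⟦ _ , _ , _ , _ ⟧ = refl

-- J squared is 4J = 0, so J - I is its own inverse in characteristic 2.
others-involutive : ∀ c → others (others c) ≡ c
others-involutive = from-yes (V₄.every? λ c → others (others c) ≟ᵥ c)

others-dot : ∀ k →
  ⟦ dot k ⟦ O , I , I , I ⟧ , dot k ⟦ I , O , I , I ⟧ , dot k ⟦ I , I , O , I ⟧ , dot k ⟦ I , I , I , O ⟧ ⟧
  ≡ others k
others-dot = from-yes (V₄.every? λ k →
  ⟦ dot k ⟦ O , I , I , I ⟧ , dot k ⟦ I , O , I , I ⟧ , dot k ⟦ I , I , O , I ⟧ , dot k ⟦ I , I , I , O ⟧ ⟧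
  ≟ᵥ others k)

pentad₀ : List (Vect 4)
pentad₀ = ⟦ I , O , O , O ⟧ ∷ ⟦ O , I , O , O ⟧ ∷ ⟦ O , O , I , O ⟧ ∷ ⟦ O , O , O , I ⟧ ∷ 𝟏 ∷ []

-- Independence of the first four vectors and the zero sum of all five are consequences: the Gram
-- matrix J - I is invertible, and `ψ-pentad` identifies the fifth vector.
IsPentad : (Vect 4 → Vect 4 → 𝔽₄) → List (Vect 4) → Set
IsPentad f ys = length ys ≡ 5 × All (λ y → f y y ≡ O) ys × AllPairs (λ x y → f x y ≡ I) ys

-- Frames with Gram matrix J - I

module Hermitian (⊥ : UnitaryPolarity 3) where
  open UnitaryPolarity ⊥ renaming (form to h) public
  open Sesquilinear sesquilinear public

  -- The Gram matrix of `w` is J - I, phrased for all combinations at once: applying `others` to the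
  -- products with `w` then recovers the coordinates.
  IsFrame : Vec (Vect 4) 4 → Set
  IsFrame w = ∀ c → Vec.map (h (combination c w)) w ≡ others c

  module Frame {w} (isFrame : IsFrame w) where

    φ ψ : Vect 4 → Vect 4
    φ c = combination c w
    ψ x = others (Vec.map (h x) w)

    ψ-φ : ∀ c → ψ (φ c) ≡ c
    ψ-φ c = trans (cong others (isFrame c)) (others-involutive c)

    φ-injective : ∀ {c d} → φ c ≡ φ d → c ≡ d
    φ-injective {c} {d} eq = trans (sym (ψ-φ c)) (trans (cong ψ eq) (ψ-φ d))

    -- The left inverse makes `φ` injective, and an injective map of the finite space to itself is
    -- onto.
    φ-ψ : ∀ x → φ (ψ x) ≡ x
    φ-ψ x = let c , φc≡x = V₄.injective⇒surjective _≟ᵥ_ φ-injective x in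
      subst (λ x → φ (ψ x) ≡ x) φc≡x (cong φ (ψ-φ c))

    ψ-injective : ∀ {x y} → ψ x ≡ ψ y → x ≡ y
    ψ-injective {x} {y} eq = trans (sym (φ-ψ x)) (trans (cong φ eq) (φ-ψ y))

    isometry : ∀ c d → h (φ c) (φ d) ≡ h₀ c d
    isometry c d = begin
      h (φ c) (φ d)                                 ≡⟨ combinationʳ d w (φ c) ⟩
      dot (conjᵥ d) (Vec.map (h (φ c)) w)           ≡⟨ cong (dot (conjᵥ d)) (isFrame c) ⟩
      dot (conjᵥ d) (others c)                      ≡⟨ h₀-dot c d ⟨
      h₀ c d                                        ∎
      where open ≡-Reasoning

    φ-⊕ : ∀ c d → φ (c ⊕ d) ≡ φ c ⊕ φ d
    φ-⊕ c d = combination-⊕ c d w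

    φ-• : ∀ a c → φ (a • c) ≡ a • φ c
    φ-• a c = combination-• a c w

    ψ-⊕ : ∀ x y → ψ (x ⊕ y) ≡ ψ x ⊕ ψ y
    ψ-⊕ x y = φ-injective (begin
      φ (ψ (x ⊕ y))        ≡⟨ φ-ψ (x ⊕ y) ⟩
      x ⊕ y                ≡⟨ cong₂ _⊕_ (φ-ψ x) (φ-ψ y) ⟨
      φ (ψ x) ⊕ φ (ψ y)    ≡⟨ φ-⊕ (ψ x) (ψ y) ⟨
      φ (ψ x ⊕ ψ y)        ∎)
      where open ≡-Reasoning

    ψ-• : ∀ a x → ψ (a • x) ≡ a • ψ x
    ψ-• a x = φ-injective (begin
      φ (ψ (a • x))    ≡⟨ φ-ψ (a • x) ⟩
      a • x            ≡⟨ cong (a •_) (φ-ψ x) ⟨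
      a • φ (ψ x)      ≡⟨ φ-• a (ψ x) ⟨
      φ (a • ψ x)      ∎)
      where open ≡-Reasoning

    φ-𝟎 : φ 𝟎 ≡ 𝟎
    φ-𝟎 = begin
      φ 𝟎          ≡⟨ cong φ (⊕-self 𝟎) ⟨
      φ (𝟎 ⊕ 𝟎)    ≡⟨ φ-⊕ 𝟎 𝟎 ⟩
      φ 𝟎 ⊕ φ 𝟎    ≡⟨ ⊕-self (φ 𝟎) ⟩
      𝟎            ∎
      where open ≡-Reasoning

    φ-nonzero : ∀ {c} → c ≢ 𝟎 → φ c ≢ 𝟎
    φ-nonzero c≢𝟎 φc≡𝟎 = c≢𝟎 (φ-injective (trans φc≡𝟎 (sym φ-𝟎)))

    ψ-nonzero : ∀ {x} → x ≢ 𝟎 → ψ x ≢ 𝟎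
    ψ-nonzero {x} x≢𝟎 ψx≡𝟎 = x≢𝟎 (trans (sym (φ-ψ x)) (trans (cong φ ψx≡𝟎) φ-𝟎))

    h-ψ : ∀ x y → h x y ≡ h₀ (ψ x) (ψ y)
    h-ψ x y = trans (cong₂ h (sym (φ-ψ x)) (sym (φ-ψ y))) (isometry (ψ x) (ψ y))

  frameOf : ∀ {ys} → IsPentad h ys → Vec (Vect 4) 4
  frameOf {a ∷ b ∷ c ∷ d ∷ e ∷ []} _ = ⟦ a , b , c , d ⟧

  private
    cong₄ : ∀ {A : Set} {a b c d a′ b′ c′ d′ : A} → a ≡ a′ → b ≡ b′ → c ≡ c′ → d ≡ d′ →
            _≡_ {A = Vec A 4} ⟦ a , b , c , d ⟧ ⟦ a′ , b′ , c′ , d′ ⟧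
    cong₄ refl refl refl refl = refl

    flip : ∀ {x y} → h x y ≡ I → h y x ≡ I
    flip {x} {y} eq = trans (hermitian x y) (cong conj eq)

  pentad-isFrame : ∀ {ys} (p : IsPentad h ys) → IsFrame (frameOf p)
  pentad-isFrame {a ∷ b ∷ c ∷ d ∷ e ∷ []}
    (_ , (aa ∷ bb ∷ cc ∷ dd ∷ _) , (ab ∷ ac ∷ ad ∷ _) ∷ (bc ∷ bd ∷ _) ∷ (cd ∷ _) ∷ _) k =
    trans (Vec.map-cong (combinationˡ k ⟦ a , b , c , d ⟧) ⟦ a , b , c , d ⟧)
      (trans (cong₄ (cong (dot k) (cong₄ aa (flip ab) (flip ac) (flip ad)))
                    (cong (dot k) (cong₄ ab bb (flip bc) (flip bd)))
                    (cong (dot k) (cong₄ ac bc cc (flip cd)))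
                    (cong (dot k) (cong₄ ad bd cd dd)))
        (others-dot k))

  module Pentad {ys} (p : IsPentad h ys) where
    open Frame (pentad-isFrame p) public

    -- `ψ` sees a vector only through its products with the frame, and these are prescribed. The
    -- fifth vector has products `𝟏`, which `others` fixes, so it is the sum of the other four.
    ψ-pentad : List.map ψ ys ≡ pentad₀
    ψ-pentad = coordinates p
      where
      coordinates : ∀ {ys} (p : IsPentad h ys) → List.map (Frame.ψ (pentad-isFrame p)) ys ≡ pentad₀
      coordinates {a ∷ b ∷ c ∷ d ∷ e ∷ []}
        (_ , (aa ∷ bb ∷ cc ∷ dd ∷ _) , (ab ∷ ac ∷ ad ∷ ae ∷ _) ∷ (bc ∷ bd ∷ be ∷ _) ∷ (cd ∷ ce ∷ _) ∷ (de ∷ _) ∷ _) =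
        cong₂ _∷_ (cong others (cong₄ aa ab ac ad))
        (cong₂ _∷_ (cong others (cong₄ (flip ab) bb bc bd))
        (cong₂ _∷_ (cong others (cong₄ (flip ac) (flip bc) cc cd))
        (cong₂ _∷_ (cong others (cong₄ (flip ad) (flip bd) (flip cd) dd))
        (cong₂ _∷_ (cong others (cong₄ (flip ae) (flip be) (flip ce) (flip de))) refl))))

    φ-pentad : List.map φ pentad₀ ≡ ys
    φ-pentad = begin
      List.map φ pentad₀            ≡⟨ cong (List.map φ) ψ-pentad ⟨
      List.map φ (List.map ψ ys)    ≡⟨ List.map-∘ ys ⟨
      List.map (φ ∘ ψ) ys           ≡⟨ List.map-cong φ-ψ ys ⟩
      List.map id ys                ≡⟨ List.map-id ys ⟩
      ys                            ∎
      where open ≡-Reasoning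

-- Lines and quadrics of PG(3,2)

module _ {a} {A : Set a} where

  sums : (A → A → A) → List A → List A
  sums _∙_ []       = []
  sums _∙_ (x ∷ xs) = List.map (x ∙_) xs ++ sums _∙_ xs

  AllPairs-∈ : ∀ {ℓ} {R : A → A → Set ℓ} {xs} → Unique xs →
               (∀ {x y} → x ∈ xs → y ∈ xs → x ≢ y → R x y) → AllPairs R xs
  AllPairs-∈ []      _ = []
  AllPairs-∈ (x∉ ∷ u) f =
    All.tabulate (λ y∈ → f (here refl) (there y∈) (All.lookup x∉ y∈)) ∷
    AllPairs-∈ u (λ x∈ y∈ → f (there x∈) (there y∈))

sums-map : ∀ {a b} {A : Set a} {B : Set b} {_∙_ : A → A → A} {_∘′_ : B → B → B} (f : A → B) →
           (∀ x y → f (x ∙ y) ≡ f x ∘′ f y) → ∀ xs → List.map f (sums _∙_ xs) ≡ sums _∘′_ (List.map f xs)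
sums-map f f-∙ []       = refl
sums-map {_∙_ = _∙_} {_∘′_} f f-∙ (x ∷ xs) = begin
  List.map f (List.map (x ∙_) xs ++ sums _∙_ xs)                     ≡⟨ List.map-++ f (List.map (x ∙_) xs) (sums _∙_ xs) ⟩
  List.map f (List.map (x ∙_) xs) ++ List.map f (sums _∙_ xs)        ≡⟨ cong₂ _++_ (trans (sym (List.map-∘ xs)) (trans (List.map-cong (f-∙ x) xs) (List.map-∘ xs))) (sums-map f f-∙ xs) ⟩
  List.map (f x ∘′_) (List.map f xs) ++ sums _∘′_ (List.map f xs)    ∎
  where open ≡-Reasoning

module _ {c ℓ} {S : Setoid c ℓ} where
  open Setoid S using (Carrier; _≈_)

  size-1⁺ : (x : Carrier) → (∀ y → x ≈ y) → HasSize S 1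
  size-1⁺ x x≈ = record
    { to = λ _ → Fin.zero ; from = λ _ → x
    ; to-cong = λ _ → refl ; from-cong = λ _ → Setoid.refl S
    ; inverse = (λ { {Fin.zero} _ → refl }) , λ {y} _ → x≈ y }

  size-1⁻ : HasSize S 1 → ∀ x y → x ≈ y
  size-1⁻ f x y = Setoid.trans S (Setoid.sym S (strictlyInverseʳ x))
    (Setoid.trans S (from-cong (all-equal (to x) (to y))) (strictlyInverseʳ y))
    where
    open Inverse f
    all-equal : ∀ (i j : Fin 1) → i ≡ j
    all-equal Fin.zero Fin.zero = refl

Bits : Set
Bits = P₂.Vect 4

booleans : List Bool
booleans = false ∷ true ∷ []

∈-booleans : ∀ b → b ∈ booleans
∈-booleans false = here refl
∈-booleans true  = there (here refl)

module V₂ = Vectors (from-yes (allPairs? (λ x y → ¬? (x Bool.≟ y)) booleans)) ∈-booleans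

_≟₂_ : DecidableEquality Bits
_≟₂_ = Vec.≡-dec Bool._≟_

open import Data.List.Membership.DecPropositional _≟₂_ using () renaming (_∈?_ to _∈₂?_)

infixl 6 _⊞_
_⊞_ : Bits → Bits → Bits
_⊞_ = P₂._⊕_

𝟘 : Bits
𝟘 = P₂.𝟎

⊞-zero : ∀ u v → u ⊞ v ≡ 𝟘 → u ≡ v
⊞-zero = from-yes (V₂.every? λ u → V₂.every? λ v → ((u ⊞ v) ≟₂ 𝟘) →-dec (u ≟₂ v))

span-left : ∀ u v → true P₂.• u ⊞ false P₂.• v ≡ u
span-left u v = trans (cong₂ _⊞_ (Vec.map-id u) (Vec.map-const v false)) (Vec.zipWith-identityʳ Bool.xor-identityʳ u)

span-right : ∀ u v → false P₂.• u ⊞ true P₂.• v ≡ v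
span-right u v = trans (cong₂ _⊞_ (Vec.map-const u false) (Vec.map-id v)) (Vec.zipWith-identityˡ Bool.xor-identityˡ v)

span-both : ∀ u v → true P₂.• u ⊞ true P₂.• v ≡ u ⊞ v
span-both u v = cong₂ _⊞_ (Vec.map-id u) (Vec.map-id v)

span-neither : ∀ u v → false P₂.• u ⊞ false P₂.• v ≡ 𝟘
span-neither u v = cong₂ _⊞_ (Vec.map-const u false) (Vec.map-const v false)

∝⇒≡ : ∀ {u v : Bits} → u ≢ 𝟘 → u P₂.∝ v → u ≡ v
∝⇒≡ {v = v} u≢𝟘 (false , refl) = contradiction (Vec.map-const v false) u≢𝟘
∝⇒≡ {v = v} u≢𝟘 (true  , refl) = Vec.map-id v

≡⇒∝ : ∀ {u v : Bits} → u ≡ v → u P₂.∝ v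
≡⇒∝ {u} refl = true , sym (Vec.map-id u)

module _ (ℓ : P₂.Line 3) where
  open P₂.Line ℓ renaming (p to P; q to Q)
  private
    p = P₂.vec P
    q = P₂.vec Q

  p≢q : p ≢ q
  p≢q p≡q = distinct (≡⇒∝ p≡q)

  third : P₂.Point 3
  third = record { vec = p ⊞ q ; nonzero = p≢q ∘ ⊞-zero p q }

  on-line : P₂.pointsOf ℓ P × P₂.pointsOf ℓ Q × P₂.pointsOf ℓ third
  on-line = (true , false , sym (span-left p q)) , (false , true , sym (span-right p q)) , (true , true , sym (span-both p q))

  line-cases : ∀ R → P₂.pointsOf ℓ R → P₂.vec R ≡ p ⊎ P₂.vec R ≡ q ⊎ P₂.vec R ≡ p ⊞ q
  line-cases R (false , false , R≡) = contradiction (trans R≡ (span-neither p q)) (P₂.nonzero R)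
  line-cases R (true  , false , R≡) = inj₁ (trans R≡ (span-left p q))
  line-cases R (false , true  , R≡) = inj₂ (inj₁ (trans R≡ (span-right p q)))
  line-cases R (true  , true  , R≡) = inj₂ (inj₂ (trans R≡ (span-both p q)))

module Alternating {f : Bits → Bits → Bool} (bilinear : P₂.IsBilinear f) (alternating : ∀ u → f u u ≡ false) where
  open P₂.IsSesquilinear bilinear

  symmetric : ∀ u v → f u v ≡ false → f v u ≡ false
  symmetric u v fuv≡false = begin
    f v u                                      ≡⟨ cong₂ (λ a b → (a xor b) xor f v u) (alternating u) fuv≡false ⟨
    (f u u xor f u v) xor f v u                ≡⟨ Bool.xor-identityʳ _ ⟨
    ((f u u xor f u v) xor f v u) xor false    ≡⟨ cong (((f u u xor f u v) xor f v u) xor_) (alternating v) ⟨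
    ((f u u xor f u v) xor f v u) xor f v v    ≡⟨ Bool.xor-assoc (f u u xor f u v) (f v u) (f v v) ⟩
    (f u u xor f u v) xor (f v u xor f v v)    ≡⟨ cong₂ _xor_ (+-right u u v) (+-right v u v) ⟨
    f u (u ⊞ v) xor f v (u ⊞ v)                ≡⟨ +-left u v (u ⊞ v) ⟨
    f (u ⊞ v) (u ⊞ v)                          ≡⟨ alternating (u ⊞ v) ⟩
    false                                      ∎
    where open ≡-Reasoning

  perp⇒totallyIsotropic : ∀ ℓ → f (P₂.vec (P₂.Line.p ℓ)) (P₂.vec (P₂.Line.q ℓ)) ≡ false → P₂.TotallyIsotropic f ℓ
  perp⇒totallyIsotropic ℓ fpq≡false {R} (a , b , R≡) R′ (a′ , b′ , R′≡) = begin
    f (P₂.vec R) (P₂.vec R′)                                          ≡⟨ cong (λ r → f r (P₂.vec R′)) R≡ ⟩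
    f (a P₂.• p ⊞ b P₂.• q) (P₂.vec R′)                               ≡⟨ +-left (a P₂.• p) (b P₂.• q) (P₂.vec R′) ⟩
    f (a P₂.• p) (P₂.vec R′) xor f (b P₂.• q) (P₂.vec R′)             ≡⟨ cong₂ _xor_ (•-left a p (P₂.vec R′)) (•-left b q (P₂.vec R′)) ⟩
    (a ∧ f p (P₂.vec R′)) xor (b ∧ f q (P₂.vec R′))                   ≡⟨ cong₂ (λ s t → (a ∧ s) xor (b ∧ t)) (perp p (alternating p) fpq≡false) (perp q (symmetric p q fpq≡false) (alternating q)) ⟩
    (a ∧ false) xor (b ∧ false)                                       ≡⟨ cong₂ _xor_ (Bool.∧-zeroʳ a) (Bool.∧-zeroʳ b) ⟩
    false                                                             ∎
    where
    open ≡-Reasoning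
    p = P₂.vec (P₂.Line.p ℓ)
    q = P₂.vec (P₂.Line.q ℓ)
    perp : ∀ u → f u p ≡ false → f u q ≡ false → f u (P₂.vec R′) ≡ false
    perp u fup fuq = begin
      f u (P₂.vec R′)                                ≡⟨ cong (f u) R′≡ ⟩
      f u (a′ P₂.• p ⊞ b′ P₂.• q)                    ≡⟨ +-right u (a′ P₂.• p) (b′ P₂.• q) ⟩
      f u (a′ P₂.• p) xor f u (b′ P₂.• q)            ≡⟨ cong₂ _xor_ (•-right a′ u p) (•-right b′ u q) ⟩
      (a′ ∧ f u p) xor (b′ ∧ f u q)                  ≡⟨ cong₂ (λ s t → (a′ ∧ s) xor (b′ ∧ t)) fup fuq ⟩
      (a′ ∧ false) xor (b′ ∧ false)                  ≡⟨ cong₂ _xor_ (Bool.∧-zeroʳ a′) (Bool.∧-zeroʳ b′) ⟩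
      false                                          ∎

-- Quadratic forms on GF(2)⁴ and their zeros

module _ (f : Bits → Bool) where

  IsZero : Bits → Set
  IsZero u = u ≢ 𝟘 × f u ≡ false

  isZero? : Decidable IsZero
  isZero? u = ¬? (u ≟₂ 𝟘) ×-dec (f u Bool.≟ false)

  zeros : List Bits
  zeros = filter isZero? (V₂.vectors 4)

  zeros-unique : Unique zeros
  zeros-unique = Unique.filter⁺ isZero? (V₂.vectors-unique 4)

  ∈-zeros⁺ : ∀ {u} → IsZero u → u ∈ zeros
  ∈-zeros⁺ {u} = ∈-filter⁺ isZero? (V₂.∈-vectors u)

  ∈-zeros⁻ : ∀ {u} → u ∈ zeros → IsZero u
  ∈-zeros⁻ u∈ = proj₂ (∈-filter⁻ isZero? {xs = V₂.vectors 4} u∈)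

-- The value of a quadratic form at x + y + z, by additivity of its polar form.
expand₃ : (x y z xy xz yz : Bool) → Bool
expand₃ x y z xy xz yz = ((((xz xor x) xor z) xor ((yz xor y) xor z)) xor z) xor xy

-- The coefficients are the values at the basis vectors and at their pairwise sums.
quadratic : Vec Bool 10 → Bits → Bool
quadratic (a ∷ b ∷ c ∷ d ∷ ab ∷ ac ∷ ad ∷ bc ∷ bd ∷ cd ∷ []) = λ where
    ⟦ false , false , false , false ⟧ → false
    ⟦ true  , false , false , false ⟧ → a
    ⟦ false , true  , false , false ⟧ → b
    ⟦ false , false , true  , false ⟧ → c
    ⟦ false , false , false , true  ⟧ → d
    ⟦ true  , true  , false , false ⟧ → ab
    ⟦ true  , false , true  , false ⟧ → ac
    ⟦ true  , false , false , true  ⟧ → ad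
    ⟦ false , true  , true  , false ⟧ → bc
    ⟦ false , true  , false , true  ⟧ → bd
    ⟦ false , false , true  , true  ⟧ → cd
    ⟦ true  , true  , true  , false ⟧ → expand₃ a b c ab ac bc
    ⟦ true  , true  , false , true  ⟧ → expand₃ a b d ab ad bd
    ⟦ true  , false , true  , true  ⟧ → acd
    ⟦ false , true  , true  , true  ⟧ → bcd
    ⟦ true  , true  , true  , true  ⟧ → expand₃ a b cd ab acd bcd
  where
  acd = expand₃ a c d ac ad cd
  bcd = expand₃ b c d bc bd cd

NoLines : (Bits → Bool) → List Bits → Set
NoLines f = AllPairs (λ u v → f (u ⊞ v) ≡ true)

FiveSpanning : List Bits → Set
FiveSpanning us = length us ≡ 5 × All (λ u → u ≡ 𝟘 ⊎ u ∈ us ++ sums _⊞_ us) (V₂.vectors 4)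

-- Ten bits determine a quadratic form in four variables over GF(2), and all 1024 forms are tried.
elliptic-zeros : ∀ q → NoLines (quadratic q) (zeros (quadratic q)) → FiveSpanning (zeros (quadratic q))
elliptic-zeros = from-yes (V₂.every? λ q → dec (quadratic q) (zeros (quadratic q)))
  where
  dec : ∀ f us → Dec (NoLines f us → FiveSpanning us)
  dec f us = allPairs? (λ u v → f (u ⊞ v) Bool.≟ true) us →-dec
    ((length us ℕ.≟ 5) ×-dec All.all? (λ u → (u ≟₂ 𝟘) ⊎-dec (u ∈₂? (us ++ sums _⊞_ us))) (V₂.vectors 4))

-- Common interface of the quadric of an arbitrary vertex (`elliptic-points`) and of the standard
-- one (`Q₀-points`), so that `ovoid-list` and `baer-list` serve both.
record QuadricPoints (f : Bits → Bool) (us : List Bits) : Set where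
  field
    sound    : ∀ {u} → u ∈ us → IsZero f u
    complete : ∀ {u} → IsZero f u → u ∈ us
    unique   : Unique us
    five     : length us ≡ 5
    spanning : ∀ {u} → u ≢ 𝟘 → u ∈ us ++ sums _⊞_ us

module _ (F : P₂.QuadraticForm 3) where
  open P₂.QuadraticForm F renaming (form to Q)

  private
    e₁ e₂ e₃ e₄ : Bits
    e₁ = ⟦ true , false , false , false ⟧
    e₂ = ⟦ false , true , false , false ⟧
    e₃ = ⟦ false , false , true , false ⟧
    e₄ = ⟦ false , false , false , true ⟧

    values : Vec Bool 10
    values = Q e₁ ∷ Q e₂ ∷ Q e₃ ∷ Q e₄ ∷ Q (e₁ ⊞ e₂) ∷ Q (e₁ ⊞ e₃) ∷ Q (e₁ ⊞ e₄)
           ∷ Q (e₂ ⊞ e₃) ∷ Q (e₂ ⊞ e₄) ∷ Q (e₃ ⊞ e₄) ∷ []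

    xor-solve : ∀ a b c {r} → (a xor b) xor c ≡ r → a ≡ (r xor c) xor b
    xor-solve false false false refl = refl
    xor-solve false false true  refl = refl
    xor-solve false true  false refl = refl
    xor-solve false true  true  refl = refl
    xor-solve true  false false refl = refl
    xor-solve true  false true  refl = refl
    xor-solve true  true  false refl = refl
    xor-solve true  true  true  refl = refl

    Q-⊞ : ∀ x y z → Q ((x ⊞ y) ⊞ z) ≡ expand₃ (Q x) (Q y) (Q z) (Q (x ⊞ y)) (Q (x ⊞ z)) (Q (y ⊞ z))
    Q-⊞ x y z = xor-solve (Q ((x ⊞ y) ⊞ z)) (Q (x ⊞ y)) (Q z) (P₂.IsSesquilinear.+-left polarBilinear x y z)

  quadratic-values : ∀ u → Q u ≡ quadratic values u
  quadratic-values ⟦ false , false , false , false ⟧ = homogeneous false 𝟘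
  quadratic-values ⟦ true  , false , false , false ⟧ = refl
  quadratic-values ⟦ false , true  , false , false ⟧ = refl
  quadratic-values ⟦ false , false , true  , false ⟧ = refl
  quadratic-values ⟦ false , false , false , true  ⟧ = refl
  quadratic-values ⟦ true  , true  , false , false ⟧ = refl
  quadratic-values ⟦ true  , false , true  , false ⟧ = refl
  quadratic-values ⟦ true  , false , false , true  ⟧ = refl
  quadratic-values ⟦ false , true  , true  , false ⟧ = refl
  quadratic-values ⟦ false , true  , false , true  ⟧ = refl
  quadratic-values ⟦ false , false , true  , true  ⟧ = refl
  quadratic-values ⟦ true  , true  , true  , false ⟧ = Q-⊞ e₁ e₂ e₃
  quadratic-values ⟦ true  , true  , false , true  ⟧ = Q-⊞ e₁ e₂ e₄
  quadratic-values ⟦ true  , false , true  , true  ⟧ = Q-⊞ e₁ e₃ e₄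
  quadratic-values ⟦ false , true  , true  , true  ⟧ = Q-⊞ e₂ e₃ e₄
  -- `e₃ ⊞ e₄` is taken as a single vector; its sums with `e₁` and `e₂` are then expanded in turn.
  quadratic-values ⟦ true  , true  , true  , true  ⟧ = trans (Q-⊞ e₁ e₂ (e₃ ⊞ e₄))
    (cong₂ (expand₃ (Q e₁) (Q e₂) (Q (e₃ ⊞ e₄)) (Q (e₁ ⊞ e₂))) (Q-⊞ e₁ e₃ e₄) (Q-⊞ e₂ e₃ e₄))

  line-in-quadric : ∀ ℓ → let p = P₂.vec (P₂.Line.p ℓ) ; q = P₂.vec (P₂.Line.q ℓ) in
    Q p ≡ false → Q q ≡ false → Q (p ⊞ q) ≡ false → ∀ {R} → P₂.pointsOf ℓ R → quadric R
  line-in-quadric ℓ Qp Qq Qpq {R} R∈ℓ with line-cases ℓ R R∈ℓ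
  ... | inj₁ R≡p        = trans (cong Q R≡p) Qp
  ... | inj₂ (inj₁ R≡q) = trans (cong Q R≡q) Qq
  ... | inj₂ (inj₂ R≡t) = trans (cong Q R≡t) Qpq

  -- Two zeros whose sum is a zero would span a line inside the quadric, so `hasNoLine` yields the
  -- premise of `elliptic-zeros`.
  elliptic-points : P₂.IsElliptic F → ∃ (QuadricPoints Q)
  elliptic-points elliptic = us , record
    { sound    = sound
    ; complete = λ {u} (u≢𝟘 , Qu) → ∈-zeros⁺ f (u≢𝟘 , trans (sym (quadratic-values u)) Qu)
    ; unique   = zeros-unique f
    ; five     = proj₁ pentad
    ; spanning = λ {u} u≢𝟘 → [ (λ u≡𝟘 → contradiction u≡𝟘 u≢𝟘) , id ]′ (All.lookup (proj₂ pentad) (V₂.∈-vectors u))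
    }
    where
    f : Bits → Bool
    f = quadratic values
    us : List Bits
    us = zeros f
    sound : ∀ {u} → u ∈ us → IsZero Q u
    sound {u} u∈ = let u≢𝟘 , fu = ∈-zeros⁻ f u∈ in u≢𝟘 , trans (quadratic-values u) fu
    noLines : NoLines f us
    noLines = AllPairs-∈ (zeros-unique f) λ {u} {v} u∈ v∈ u≢v → Bool.¬-not λ fuv →
      let u≢𝟘 , Qu = sound u∈
          v≢𝟘 , Qv = sound v∈
          ℓ : P₂.Line 3
          ℓ = record
            { p = record { vec = u ; nonzero = u≢𝟘 }
            ; q = record { vec = v ; nonzero = v≢𝟘 }
            ; distinct = λ u∝v → u≢v (∝⇒≡ u≢𝟘 u∝v) }
      in P₂.IsElliptic.hasNoLine elliptic ℓ λ {R} →
         line-in-quadric ℓ Qu Qv (trans (quadratic-values (u ⊞ v)) fuv) {R}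
    pentad : FiveSpanning us
    pentad = elliptic-zeros values noLines

-- The second elementary symmetric polynomial. At a vector of weight w its value is w(w - 1)/2
-- modulo 2, so its nonzero zeros have weight 1 or 4. Its polar form has matrix J - I, like `h₀`.
Q₀ : Bits → Bool
Q₀ ⟦ a , b , c , d ⟧ = (a ∧ (b xor (c xor d))) xor ((b ∧ (c xor d)) xor (c ∧ d))

A₀ : Bits → Bits → Bool
A₀ u v = (Q₀ (u ⊞ v) xor Q₀ u) xor Q₀ v

A₀-+-left : ∀ u v t → A₀ (u ⊞ v) t ≡ A₀ u t xor A₀ v t
A₀-+-left = from-yes (V₂.every? λ u → V₂.every? λ v → V₂.every? λ t → A₀ (u ⊞ v) t Bool.≟ (A₀ u t xor A₀ v t))

A₀-symmetric : ∀ u v → A₀ u v ≡ A₀ v u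
A₀-symmetric = from-yes (V₂.every? λ u → V₂.every? λ v → A₀ u v Bool.≟ A₀ v u)

A₀-•-left : ∀ c u v → A₀ (c P₂.• u) v ≡ c ∧ A₀ u v
A₀-•-left false = from-yes (V₂.every? λ u → V₂.every? λ v → A₀ (false P₂.• u) v Bool.≟ false)
A₀-•-left true  = from-yes (V₂.every? λ u → V₂.every? λ v → A₀ (true P₂.• u) v Bool.≟ A₀ u v)

A₀-bilinear : P₂.IsBilinear A₀
A₀-bilinear = record
  { +-left  = A₀-+-left
  ; +-right = λ u v t → trans (A₀-symmetric u (v ⊞ t))
      (trans (A₀-+-left v t u) (cong₂ _xor_ (A₀-symmetric v u) (A₀-symmetric t u)))
  ; •-left  = A₀-•-left
  ; •-right = λ c u v → trans (A₀-symmetric u (c P₂.• v)) (trans (A₀-•-left c v u) (cong (c ∧_) (A₀-symmetric v u)))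
  }

A₀-nonDegenerate : ∀ u → u ≡ 𝟘 ⊎ ∃ λ v → A₀ u v ≡ true
A₀-nonDegenerate = from-yes (V₂.every? λ u → (u ≟₂ 𝟘) ⊎-dec V₂.some? λ v → A₀ u v Bool.≟ true)

A₀-noPerp : ∀ u → u ≢ 𝟘 → ¬ (∀ v → A₀ u v ≡ false)
A₀-noPerp u u≢𝟘 perp with A₀-nonDegenerate u
... | inj₁ u≡𝟘         = u≢𝟘 u≡𝟘
... | inj₂ (v , A₀uv) = contradiction (trans (sym A₀uv) (perp v)) λ ()

A₀-polarity : P₂.SymplecticPolarity 3
A₀-polarity = record
  { form          = A₀
  ; bilinear      = A₀-bilinear
  ; alternating   = A₀-alternating
  ; nonDegenerate = λ u perp → decidable-stable (u ≟₂ 𝟘) λ u≢𝟘 → A₀-noPerp u u≢𝟘 perp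
  }
  where
  A₀-alternating : ∀ u → A₀ u u ≡ false
  A₀-alternating = from-yes (V₂.every? λ u → A₀ u u Bool.≟ false)

Q₀-form : P₂.QuadraticForm 3
Q₀-form = record
  { form          = Q₀
  ; homogeneous   = Q₀-homogeneous
  ; polarBilinear = A₀-bilinear
  }
  where
  Q₀-homogeneous : ∀ c u → Q₀ (c P₂.• u) ≡ (c ∧ c) ∧ Q₀ u
  Q₀-homogeneous false = from-yes (V₂.every? λ u → Q₀ (false P₂.• u) Bool.≟ false)
  Q₀-homogeneous true  = from-yes (V₂.every? λ u → Q₀ (true P₂.• u) Bool.≟ Q₀ u)

Q₀-no-line : ∀ u v → u ≢ 𝟘 → v ≢ 𝟘 → u ≢ v → Q₀ u ≡ false → Q₀ v ≡ false → Q₀ (u ⊞ v) ≢ false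
Q₀-no-line = from-yes (V₂.every? λ u → V₂.every? λ v →
  ¬? (u ≟₂ 𝟘) →-dec (¬? (v ≟₂ 𝟘) →-dec (¬? (u ≟₂ v) →-dec
  ((Q₀ u Bool.≟ false) →-dec ((Q₀ v Bool.≟ false) →-dec ¬? (Q₀ (u ⊞ v) Bool.≟ false))))))

Q₀-elliptic : P₂.IsElliptic Q₀-form
Q₀-elliptic = record
  { nonSingular = λ P _ → A₀-noPerp (P₂.vec P) (P₂.nonzero P)
  ; hasPoint    = record { vec = ⟦ true , false , false , false ⟧ ; nonzero = λ () } , refl
  ; hasNoLine   = λ ℓ ℓ⊆Q → let open P₂.Line ℓ ; p∈ , q∈ , t∈ = on-line ℓ in
      Q₀-no-line (P₂.vec p) (P₂.vec q) (P₂.nonzero p) (P₂.nonzero q) (p≢q ℓ)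
        (ℓ⊆Q {p} p∈) (ℓ⊆Q {q} q∈) (ℓ⊆Q {third ℓ} t∈)
  }

-- Listed in the order of `pentad₀`: for the subgeometry of a pentad, `List.map embed us₀` then
-- computes to `List.map φ pentad₀`, on which `vertex-hasPentad` relies.
us₀ : List Bits
us₀ = ⟦ true , false , false , false ⟧ ∷ ⟦ false , true , false , false ⟧ ∷ ⟦ false , false , true , false ⟧
    ∷ ⟦ false , false , false , true ⟧ ∷ ⟦ true , true , true , true ⟧ ∷ []

Q₀-points : QuadricPoints Q₀ us₀
Q₀-points = record
  { sound    = All.lookup (from-yes (All.all? (isZero? Q₀) us₀))
  ; complete = λ {u} → from-yes (V₂.every? λ u → isZero? Q₀ u →-dec (u ∈₂? us₀)) u
  ; unique   = from-yes (allPairs? (λ u v → ¬? (u ≟₂ v)) us₀)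
  ; five     = refl
  ; spanning = λ {u} → from-yes (V₂.every? λ u → ¬? (u ≟₂ 𝟘) →-dec (u ∈₂? (us₀ ++ sums _⊞_ us₀))) u
  }

-- `A₀ u v` is the sum of the values of `Q₀` at the three points u, v, u + v of the line. It
-- vanishes exactly when an odd number of them lie on the quadric, and three is excluded by
-- `Q₀-no-line`.
Q₀-tangent⇔isotropic : ∀ ℓ → P₂.Tangent (P₂.QuadraticForm.quadric Q₀-form) ℓ ⇔ P₂.TotallyIsotropic A₀ ℓ
Q₀-tangent⇔isotropic ℓ = mk⇔
  (λ tangent {R} → perp⇒totallyIsotropic ℓ (secant tangent _ _ _ refl refl refl) {R})
  λ isotropic → tangent (isotropic {p} p∈ q q∈) _ _ _ refl refl refl
  where
  open P₂.Line ℓ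
  open Alternating A₀-bilinear (P₂.SymplecticPolarity.alternating A₀-polarity)

  u v t : Bits
  u = P₂.vec p
  v = P₂.vec q
  t = u ⊞ v

  p∈ : P₂.pointsOf ℓ p
  p∈ = proj₁ (on-line ℓ)
  q∈ : P₂.pointsOf ℓ q
  q∈ = proj₁ (proj₂ (on-line ℓ))
  t∈ : P₂.pointsOf ℓ (third ℓ)
  t∈ = proj₂ (proj₂ (on-line ℓ))

  u≢t : u ≢ t
  u≢t = from-yes (V₂.every? λ u → V₂.every? λ v → ¬? (v ≟₂ 𝟘) →-dec ¬? (u ≟₂ (u ⊞ v))) u v (P₂.nonzero q)
  v≢t : v ≢ t
  v≢t = from-yes (V₂.every? λ u → V₂.every? λ v → ¬? (u ≟₂ 𝟘) →-dec ¬? (v ≟₂ (u ⊞ v))) u v (P₂.nonzero p)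

  secant : P₂.Tangent (P₂.QuadraticForm.quadric Q₀-form) ℓ →
           ∀ a b c → Q₀ u ≡ a → Q₀ v ≡ b → Q₀ t ≡ c → A₀ u v ≡ false
  secant tangent = λ where
      false false false Qu Qv Qt → two p q p∈ q∈ Qu Qv (p≢q ℓ)
      false false true  Qu Qv Qt → two p q p∈ q∈ Qu Qv (p≢q ℓ)
      false true  false Qu Qv Qt → two p (third ℓ) p∈ t∈ Qu Qt u≢t
      true  false false Qu Qv Qt → two q (third ℓ) q∈ t∈ Qv Qt v≢t
      false true  true  Qu Qv Qt → cong₂ _xor_ (cong₂ _xor_ Qt Qu) Qv
      true  false true  Qu Qv Qt → cong₂ _xor_ (cong₂ _xor_ Qt Qu) Qv
      true  true  false Qu Qv Qt → cong₂ _xor_ (cong₂ _xor_ Qt Qu) Qv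
      true  true  true  Qu Qv Qt → contradiction (proj₂ (proj₂ point)) (none Qu Qv Qt (line-cases ℓ (proj₁ point) (proj₁ (proj₂ point))))
    where
    point : ∃ (P₂.pointsOf ℓ ∩ P₂.QuadraticForm.quadric Q₀-form)
    point = Inverse.from tangent Fin.zero
    two : ∀ P R → P₂.pointsOf ℓ P → P₂.pointsOf ℓ R → Q₀ (P₂.vec P) ≡ false → Q₀ (P₂.vec R) ≡ false →
          P₂.vec P ≢ P₂.vec R → A₀ u v ≡ false
    two P R P∈ R∈ QP QR P≢R =
      contradiction (∝⇒≡ (P₂.nonzero P) (size-1⁻ tangent (P , P∈ , QP) (R , R∈ , QR))) P≢R
    none : Q₀ u ≡ true → Q₀ v ≡ true → Q₀ t ≡ true → ∀ {r} → r ≡ u ⊎ r ≡ v ⊎ r ≡ t → Q₀ r ≢ false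
    none Qu Qv Qt (inj₁ refl) Qr        = contradiction (trans (sym Qr) Qu) λ ()
    none Qu Qv Qt (inj₂ (inj₁ refl)) Qr = contradiction (trans (sym Qr) Qv) λ ()
    none Qu Qv Qt (inj₂ (inj₂ refl)) Qr = contradiction (trans (sym Qr) Qt) λ ()

  tangent : A₀ u v ≡ false → ∀ a b c → Q₀ u ≡ a → Q₀ v ≡ b → Q₀ t ≡ c →
            P₂.Tangent (P₂.QuadraticForm.quadric Q₀-form) ℓ
  tangent uv = λ where
      false true  true  Qu Qv Qt → only p p∈ Qu λ where
        (inj₁ refl)        _  → refl
        (inj₂ (inj₁ refl)) Qr → contradiction (trans (sym Qr) Qv) λ ()
        (inj₂ (inj₂ refl)) Qr → contradiction (trans (sym Qr) Qt) λ ()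
      true  false true  Qu Qv Qt → only q q∈ Qv λ where
        (inj₁ refl)        Qr → contradiction (trans (sym Qr) Qu) λ ()
        (inj₂ (inj₁ refl)) _  → refl
        (inj₂ (inj₂ refl)) Qr → contradiction (trans (sym Qr) Qt) λ ()
      true  true  false Qu Qv Qt → only (third ℓ) t∈ Qt λ where
        (inj₁ refl)        Qr → contradiction (trans (sym Qr) Qu) λ ()
        (inj₂ (inj₁ refl)) Qr → contradiction (trans (sym Qr) Qv) λ ()
        (inj₂ (inj₂ refl)) _  → refl
      false false false Qu Qv Qt →
        contradiction Qt (Q₀-no-line u v (P₂.nonzero p) (P₂.nonzero q) (p≢q ℓ) Qu Qv)
      false false true  Qu Qv Qt → odd Qu Qv Qt
      false true  false Qu Qv Qt → odd Qu Qv Qt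
      true  false false Qu Qv Qt → odd Qu Qv Qt
      true  true  true  Qu Qv Qt → odd Qu Qv Qt
    where
    only : ∀ P → P₂.pointsOf ℓ P → Q₀ (P₂.vec P) ≡ false →
           (∀ {r} → r ≡ u ⊎ r ≡ v ⊎ r ≡ t → Q₀ r ≡ false → r ≡ P₂.vec P) →
           P₂.Tangent (P₂.QuadraticForm.quadric Q₀-form) ℓ
    only P P∈ QP unique = size-1⁺ (P , P∈ , QP) λ (R , R∈ , QR) →
      ≡⇒∝ (sym (unique (line-cases ℓ R R∈) QR))
    -- The last argument is solved by computation once the three values are constants; it says that
    -- their sum is 1, against `uv`.
    odd : ∀ {A : Set} {a b c} → Q₀ u ≡ a → Q₀ v ≡ b → Q₀ t ≡ c → {T ((c xor a) xor b)} → A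
    odd Qu Qv Qt {odd} = contradiction (subst T (trans (sym (cong₂ _xor_ (cong₂ _xor_ Qt Qu) Qv)) uv) odd) λ ()

-- From vertices to pentads

infix 4 _∈ₚ_
_∈ₚ_ : Vect 4 → List (Vect 4) → Set
x ∈ₚ ys = Any (x ∝_) ys

∝-sym : ∀ (P Q : Point 3) → P ≈ₚ Q → vec Q ∝ vec P
∝-sym P Q = Setoid.sym (P₄.points 3) {P} {Q}

module Embedding (B : BaerSubgeometry) where
  open BaerSubgeometry B

  embed-⊞ : ∀ u v → embed (u ⊞ v) ≡ embed u ⊕ embed v
  embed-⊞ u v = trans (cong (λ c → combination c basis) (ι-⊞ u v)) (combination-⊕ (Vec.map ι u) (Vec.map ι v) basis)
    where
    ι-⊞ : ∀ {n} (u v : P₂.Vect n) → Vec.map ι (u P₂.⊕ v) ≡ Vec.map ι u ⊕ Vec.map ι v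
    ι-⊞ []          []          = refl
    ι-⊞ (false ∷ u) (b     ∷ v) = cong (ι b ∷_) (ι-⊞ u v)
    ι-⊞ (true  ∷ u) (false ∷ v) = cong (I ∷_) (ι-⊞ u v)
    ι-⊞ (true  ∷ u) (true  ∷ v) = cong (O ∷_) (ι-⊞ u v)

  embed-nonzero : ∀ {u} → u ≢ 𝟘 → embed u ≢ 𝟎
  embed-nonzero {u} u≢𝟘 eq = u≢𝟘
    (from-yes (V₂.every? λ u → (Vec.map ι u ≟ᵥ 𝟎) →-dec (u ≟₂ 𝟘)) u (independent _ eq))

  point : P₂.Point 3 → Point 3
  point u = record { vec = embed (P₂.vec u) ; nonzero = embed-nonzero (P₂.nonzero u) }

  image-list : ∀ (S : P₂.PointSet 3) us → (∀ u → S u → P₂.vec u ∈ us) →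
               (∀ {u} → u ∈ us → ∃ λ p → S p × P₂.vec p ≡ u) →
               ∀ P → image S P ⇔ vec P ∈ₚ List.map embed us
  image-list S us complete sound P = mk⇔
    (λ (u , Su , P∝) → lose (∈-map⁺ embed (complete u Su)) P∝)
    (λ P∈ → let y , y∈ , P∝y = find P∈
                u , u∈ , y≡ = ∈-map⁻ embed y∈
                p , Sp , p≡u = sound u∈
            in p , Sp , subst (vec P ∝_) (trans y≡ (cong embed (sym p≡u))) P∝y)

module Vertices (⊥ : UnitaryPolarity 3) where
  open Hermitian ⊥ public

  -- All that the graph sees of a vertex: its two point sets, both read off from one list of
  -- vectors. The forms, the basis and the involution are left behind here.
  record HasPentad (x : Vertex ⊥) (ys : List (Vect 4)) : Set where
    field
      isPentad : IsPentad h ys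
      ovoid    : ∀ P → ovoidOf x P ⇔ vec P ∈ₚ ys
      baer     : ∀ P → subquadrangleOf x P ⇔ vec P ∈ₚ ys ++ sums _⊕_ ys

  module _ (W : SymplecticSubquadrangle ⊥) (𝒪 : EllipticOvoid W) where
    open SymplecticSubquadrangle W
    open EllipticOvoid 𝒪 using (quadraticForm; isElliptic; tangents; quadric)
    open P₂.QuadraticForm quadraticForm using () renaming (form to Q)
    open Embedding (SymplecticSubquadrangle.baer W)
    open P₂.SymplecticPolarity polarity using () renaming (form to a)
    open P₄.SymplecticPolarity ⊥̃ using () renaming (form to b)
    private module b = Sesquilinear (P₄.SymplecticPolarity.bilinear ⊥̃)

    module _ {us} (points : QuadricPoints Q us) where
      open QuadricPoints points

      private
        point-of : ∀ {u} → u ≢ 𝟘 → P₂.Point 3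
        point-of {u} u≢𝟘 = record { vec = u ; nonzero = u≢𝟘 }

      span-nonzero : ∀ {u} → u ∈ us ++ sums _⊞_ us → u ≢ 𝟘
      span-nonzero {u} u∈ with ∈-++⁻ us u∈
      ... | inj₁ u∈us  = proj₁ (sound u∈us)
      ... | inj₂ u∈sum = ∈-sums-nonzero us unique u∈sum
        where
        ∈-sums-nonzero : ∀ us → Unique us → ∀ {s} → s ∈ sums _⊞_ us → s ≢ 𝟘
        ∈-sums-nonzero (u ∷ us) (u∉us ∷ un) s∈ with ∈-++⁻ (List.map (u ⊞_) us) s∈
        ... | inj₂ s∈us = ∈-sums-nonzero us un s∈us
        ... | inj₁ s∈us with v , v∈us , refl ← ∈-map⁻ (u ⊞_) s∈us =
          λ u⊞v≡𝟘 → All.lookup u∉us v∈us (⊞-zero u v u⊞v≡𝟘)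

      ovoid-list : ∀ P → image quadric P ⇔ vec P ∈ₚ List.map embed us
      ovoid-list = image-list quadric us (λ u Qu → complete (P₂.nonzero u , Qu))
        λ u∈ → let u≢𝟘 , Qu = sound u∈ in point-of u≢𝟘 , Qu , refl

      baer-list : ∀ P → pointSet P ⇔ vec P ∈ₚ List.map embed us ++ sums _⊕_ (List.map embed us)
      baer-list P = subst (λ ys → pointSet P ⇔ vec P ∈ₚ ys)
        (trans (List.map-++ embed us (sums _⊞_ us)) (cong (List.map embed us ++_) (sums-map embed embed-⊞ us)))
        (image-list (λ _ → ⊤) (us ++ sums _⊞_ us) (λ u _ → spanning (P₂.nonzero u))
          (λ u∈ → point-of (span-nonzero u∈) , _ , refl) P)

      private
        fixed-point : ∀ u → P₄.SemilinearInvolution.Fixed σ (point u)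
        fixed-point u = proj₂ fixed {point u} (u , _ , Setoid.refl (P₄.points 3) {point u})

        perp-point : ∀ {θ f} → P₄.IsSesquilinear θ f → ∀ u v → f (vec (point u)) (vec (point v)) ≡ O →
                     polar f (point v ≈ₚ_) (point u)
        perp-point {θ} {f} sesquilinear u v fuv≡O P v≈P with c , P≡ ← ∝-sym (point v) P v≈P = begin
          f (vec (point u)) (vec P)                  ≡⟨ cong (f (vec (point u))) P≡ ⟩
          f (vec (point u)) (c • vec (point v))      ≡⟨ P₄.IsSesquilinear.•-right sesquilinear c _ _ ⟩
          θ c * f (vec (point u)) (vec (point v))    ≡⟨ cong (θ c *_) fuv≡O ⟩
          θ c * O                                    ≡⟨ GF4-Properties.*-zeroʳ (θ c) ⟩
          O                                          ∎
          where open ≡-Reasoning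

      -- Points of Σ are fixed by `σ`, so `⊥̃⊥≐σ` puts v into the ⊥-polar of the ⊥̃-polar of v, to
      -- which u belongs. `h⇒perp` argues in the same way with the product of the polarities in the
      -- other order.
      perp⇒h : ∀ u v → a (P₂.vec u) (P₂.vec v) ≡ false → h (vec (point v)) (vec (point u)) ≡ O
      perp⇒h u v auv = proj₂ (⊥̃⊥≐σ (point v)) {point v} (fixed-point v) (point u)
        (perp-point (P₄.SymplecticPolarity.bilinear ⊥̃) u v (Equivalence.to (extends u v) auv))

      h⇒perp : ∀ u v → h (vec (point u)) (vec (point v)) ≡ O → a (P₂.vec v) (P₂.vec u) ≡ false
      h⇒perp u v huv = Equivalence.from (extends v u)
        (proj₂ (⊥⊥̃≐σ (point v)) {point v} (fixed-point v) (point u)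
          (perp-point sesquilinear u v huv))

      private
        open P₂.SymplecticPolarity polarity using (bilinear; alternating)
        open Alternating bilinear alternating

        -- Perpendicular points span a generator, and by `tangents` a generator meets the quadric
        -- only once.
        secant : ∀ {u v} → u ∈ us → v ∈ us → u ≢ v → a u v ≡ true
        secant {u} {v} u∈ v∈ u≢v = Bool.¬-not λ auv →
          let u≢𝟘 , Qu = sound u∈
              v≢𝟘 , Qv = sound v∈
              ℓ : P₂.Line 3
              ℓ = record { p = point-of u≢𝟘 ; q = point-of v≢𝟘 ; distinct = λ u∝v → u≢v (∝⇒≡ u≢𝟘 u∝v) }
              p∈ , q∈ , _ = on-line ℓ
          in u≢v (∝⇒≡ u≢𝟘 (size-1⁻ (Equivalence.from (tangents ℓ) λ {R} → perp⇒totallyIsotropic ℓ auv {R})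
                    (point-of u≢𝟘 , p∈ , Qu) (point-of v≢𝟘 , q∈ , Qv)))

        h-secant : ∀ {u v} → u ∈ us → v ∈ us → u ≢ v → h (embed u) (embed v) ≢ O
        h-secant u∈ v∈ u≢v huv = contradiction (secant v∈ u∈ (≢-sym u≢v))
          (Bool.not-¬ (h⇒perp (point-of (proj₁ (sound u∈))) (point-of (proj₁ (sound v∈))) huv))

        -- Over GF(2) the values `a u t` and `a v t` are both 1 and cancel, so u + v is
        -- perpendicular to t; `perp⇒h` carries this over to `h`.
        h-equal : ∀ {u v t} → u ∈ us → v ∈ us → t ∈ us → u ≢ v → u ≢ t → v ≢ t →
                  h (embed t) (embed u) ≡ h (embed t) (embed v)
        h-equal {u} {v} {t} u∈ v∈ t∈ u≢v u≢t v≢t = GF4-Properties.+-zero _ _ (begin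
          h (embed t) (embed u) + h (embed t) (embed v)    ≡⟨ +-right (embed t) (embed u) (embed v) ⟨
          h (embed t) (embed u ⊕ embed v)                  ≡⟨ cong (h (embed t)) (embed-⊞ u v) ⟨
          h (embed t) (embed (u ⊞ v))                      ≡⟨ perp⇒h (point-of (u≢v ∘ ⊞-zero u v)) (point-of (proj₁ (sound t∈))) perp ⟩
          O                                                ∎)
          where
          open ≡-Reasoning
          perp : a (u ⊞ v) t ≡ false
          perp = trans (P₂.IsSesquilinear.+-left bilinear u v t) (cong₂ _xor_ (secant u∈ t∈ u≢t) (secant v∈ t∈ v≢t))

        another : ∀ u v → ∃ λ t → t ∈ us × u ≢ t × v ≢ t
        another u v = let t , t∈ , u≢t , v≢t = find (decidable-stable
                            (Any.any? (λ t → ¬? (u ≟₂ t) ×-dec ¬? (v ≟₂ t)) us) λ none →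
                            five≰two (Unique-⊆-length unique λ {t} t∈ → within none t∈))
                      in t , t∈ , u≢t , v≢t
          where
          five≰two : ¬ (length us ℕ.≤ 2)
          five≰two rewrite five = λ { (ℕ.s≤s (ℕ.s≤s ())) }
          within : ¬ Any (λ t → u ≢ t × v ≢ t) us → ∀ {t} → t ∈ us → t ∈ u ∷ v ∷ []
          within none {t} t∈ with u ≟₂ t | v ≟₂ t
          ... | yes u≡t | _       = here (sym u≡t)
          ... | no _    | yes v≡t = there (here (sym v≡t))
          ... | no u≢t  | no v≢t  = contradiction (lose t∈ (u≢t , v≢t)) none

        -- For distinct u, v, t the scalars h(u,v) = h(u,t), h(v,u) = h(v,t) and h(t,u) = h(t,v) are
        -- pairwise conjugate, so they all lie in the fixed field of conj.
        h-one : ∀ {u v} → u ∈ us → v ∈ us → u ≢ v → h (embed u) (embed v) ≡ I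
        h-one {u} {v} u∈ v∈ u≢v = let t , t∈ , u≢t , v≢t = another u v in
          real-nonzero _ (begin
            conj (h (embed u) (embed v))    ≡⟨ hermitian (embed u) (embed v) ⟨
            h (embed v) (embed u)           ≡⟨ h-equal u∈ t∈ v∈ u≢t u≢v (≢-sym v≢t) ⟩
            h (embed v) (embed t)           ≡⟨ hermitian (embed t) (embed v) ⟩
            conj (h (embed t) (embed v))    ≡⟨ cong conj (h-equal v∈ u∈ t∈ (≢-sym u≢v) v≢t u≢t) ⟩
            conj (h (embed t) (embed u))    ≡⟨ hermitian (embed t) (embed u) ⟨
            h (embed u) (embed t)           ≡⟨ h-equal t∈ v∈ u∈ (≢-sym v≢t) (≢-sym u≢t) (≢-sym u≢v) ⟩
            h (embed u) (embed v)           ∎)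
            (h-secant u∈ v∈ u≢v)
          where
          open ≡-Reasoning
          real-nonzero : ∀ x → conj x ≡ x → x ≢ O → x ≡ I
          real-nonzero O _ x≢O = contradiction refl x≢O
          real-nonzero I _ _   = refl

      isPentad-image : IsPentad h (List.map embed us)
      isPentad-image = trans (List.length-map embed us) five
        , All.map⁺ (All.tabulate λ u∈ → let u = point-of (proj₁ (sound u∈)) in perp⇒h u u (alternating (P₂.vec u)))
        , AllPairs.map⁺ (AllPairs-∈ unique h-one)

  opaque
    -- Opaque, so that the filtered list of zeros behind a pentad is not unfolded later.
    hasPentad : ∀ x → ∃ (HasPentad x)
    hasPentad (W , 𝒪) =
      let us , points = elliptic-points (EllipticOvoid.quadraticForm 𝒪) (EllipticOvoid.isElliptic 𝒪) in
      _ , record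
        { isPentad = isPentad-image W 𝒪 points
        ; ovoid    = ovoid-list W 𝒪 points
        ; baer     = baer-list W 𝒪 points
        }

-- From pentads to vertices

conj-isRingIsomorphism : IsRingIsomorphism (DiscreteField.rawRing GF4) (DiscreteField.rawRing GF4) conj
conj-isRingIsomorphism = record
  { isRingMonomorphism = record
    { isRingHomomorphism = record
      { isSemiringHomomorphism = record
        { isNearSemiringHomomorphism = record
          { +-isMonoidHomomorphism = record
            { isMagmaHomomorphism = record
              { isRelHomomorphism = record { cong = cong conj }
              ; homo              = GF4-Properties.conj-+ }
            ; ε-homo = refl }
          ; *-homo = GF4-Properties.conj-* }
        ; 1#-homo = refl }
      ; -‿homo = λ _ → refl }
    ; injective = λ {x} {y} eq → trans (sym (GF4-Properties.conj-involutive x))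
        (trans (cong conj eq) (GF4-Properties.conj-involutive y)) }
  ; surjective = λ y → conj y , λ { refl → GF4-Properties.conj-involutive y }
  }

-- Conjugating the second argument turns `h₀` into the bilinear form with matrix J - I, which is
-- symmetric with zero diagonal.
h₀-alternating : ∀ c → h₀ c (conjᵥ c) ≡ O
h₀-alternating = from-yes (V₄.every? λ c → h₀ c (conjᵥ c) ≟₄ O)

h₀-ι : ∀ u v → h₀ (Vec.map ι u) (conjᵥ (Vec.map ι v)) ≡ ι (A₀ u v)
h₀-ι = from-yes (V₂.every? λ u → V₂.every? λ v → h₀ (Vec.map ι u) (conjᵥ (Vec.map ι v)) ≟₄ ι (A₀ u v))

conj-ι : ∀ u → conjᵥ (Vec.map ι u) ≡ Vec.map {n = 4} ι u
conj-ι = from-yes (V₂.every? {4} λ u → conjᵥ (Vec.map ι u) ≟ᵥ Vec.map ι u)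

-- Conjugation is squaring, so every entry t of x satisfies t² = c t and is `O` or `c`.
hilbert90 : ∀ (x : Vect 4) c → conjᵥ x ≡ c • x → ∃ λ (u : Bits) → x ≡ c • Vec.map ι u
hilbert90 = from-yes (V₄.every? λ x → all? λ c → (conjᵥ x ≟ᵥ (c • x)) →-dec V₂.some? {4} λ u → x ≟ᵥ (c • Vec.map ι u))

module StandardVertex (⊥ : UnitaryPolarity 3) {ys} (p : IsPentad (UnitaryPolarity.form ⊥) ys) where
  open Vertices ⊥
  open Pentad p

  -- Conjugation of the coordinates in the frame of the pentad. Its fixed points are those with
  -- coordinates in GF(2) up to a scalar, which are the Baer subgeometry `baer₀` spanned by the
  -- frame.
  σ : Vect 4 → Vect 4
  σ x = φ (conjᵥ (ψ x))

  ψ-σ : ∀ x → ψ (σ x) ≡ conjᵥ (ψ x)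
  ψ-σ x = ψ-φ (conjᵥ (ψ x))

  σ-⊕ : ∀ x y → σ (x ⊕ y) ≡ σ x ⊕ σ y
  σ-⊕ x y = trans (cong φ (trans (cong conjᵥ (ψ-⊕ x y)) (conjᵥ-⊕ (ψ x) (ψ y)))) (φ-⊕ (conjᵥ (ψ x)) (conjᵥ (ψ y)))

  σ-• : ∀ a x → σ (a • x) ≡ conj a • σ x
  σ-• a x = trans (cong φ (trans (cong conjᵥ (ψ-• a x)) (conjᵥ-• a (ψ x)))) (φ-• (conj a) (conjᵥ (ψ x)))

  σ-involutive : ∀ x → σ (σ x) ≡ x
  σ-involutive x = trans (cong φ (trans (cong conjᵥ (ψ-σ x)) (conjᵥ-involutive (ψ x)))) (φ-ψ x)

  σ-involution : P₄.SemilinearInvolution 3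
  σ-involution = record
    { θ            = conj
    ; automorphism = conj-isRingIsomorphism
    ; map-vec      = σ
    ; additive     = σ-⊕
    ; semilinear   = σ-•
    ; injective    = λ x σx≡𝟎 → trans (sym (σ-involutive x)) (trans (cong σ σx≡𝟎) σ-𝟎)
    ; involutive   = λ P → I , trans (σ-involutive (vec P)) (sym (•-identity (vec P)))
    -- The second coordinate would force the scalar to be `I`, but conjugation moves the first
    -- coordinate `ω`.
    ; nontrivial   = record { vec = φ ⟦ ω , I , O , O ⟧ ; nonzero = φ-nonzero {⟦ ω , I , O , O ⟧} λ () } , λ (c , eq) →
        moved c (begin
          ⟦ ω² , I , O , O ⟧                  ≡⟨ cong conjᵥ (ψ-φ ⟦ ω , I , O , O ⟧) ⟨
          conjᵥ (ψ (φ ⟦ ω , I , O , O ⟧))     ≡⟨ ψ-σ (φ ⟦ ω , I , O , O ⟧) ⟨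
          ψ (σ (φ ⟦ ω , I , O , O ⟧))         ≡⟨ cong ψ eq ⟩
          ψ (c • φ ⟦ ω , I , O , O ⟧)         ≡⟨ cong ψ (φ-• c ⟦ ω , I , O , O ⟧) ⟨
          ψ (φ (c • ⟦ ω , I , O , O ⟧))       ≡⟨ ψ-φ (c • ⟦ ω , I , O , O ⟧) ⟩
          c • ⟦ ω , I , O , O ⟧               ∎)
    }
    where
    open ≡-Reasoning
    σ-𝟎 : σ 𝟎 ≡ 𝟎
    σ-𝟎 = trans (cong σ (sym (•-zeroˡ 𝟎))) (trans (σ-• O 𝟎) (•-zeroˡ (σ 𝟎)))
    moved : ∀ c → ⟦ ω² , I , O , O ⟧ ≢ c • ⟦ ω , I , O , O ⟧
    moved O  ()
    moved I  ()
    moved ω  ()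
    moved ω² ()

  -- The form of ⊥̃ is forced by the requirement that ⊥̃ followed by ⊥ be `σ`. The two conjugations
  -- in the second argument cancel, which makes it bilinear; in the frame its matrix is J - I.
  b : Vect 4 → Vect 4 → 𝔽₄
  b x y = h x (σ y)

  h-b : ∀ x y → h x y ≡ b x (σ y)
  h-b x y = cong (h x) (sym (σ-involutive y))

  b-bilinear : P₄.IsBilinear b
  b-bilinear = record
    { +-left  = λ x y z → +-left x y (σ z)
    ; +-right = λ x y z → trans (cong (h x) (σ-⊕ y z)) (+-right x (σ y) (σ z))
    ; •-left  = λ c x y → •-left c x (σ y)
    ; •-right = λ c x y → trans (cong (h x) (σ-• c y)) (trans (•-right (conj c) x (σ y))
        (cong (_* b x y) (GF4-Properties.conj-involutive c)))
    }

  b-alternating : ∀ x → b x x ≡ O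
  b-alternating x = trans (h-ψ x (σ x)) (trans (cong (h₀ (ψ x)) (ψ-σ x)) (h₀-alternating (ψ x)))

  b-symmetric : ∀ x y → b y x ≡ b x y
  b-symmetric x y = GF4-Properties.+-zero _ _ (begin
    b y x + b x y                            ≡⟨ cong₂ _+_ (GF4-Properties.+-identityʳ (b y x)) refl ⟨
    (b y x + O) + b x y                      ≡⟨ cong (λ z → (b y x + z) + b x y) (b-alternating y) ⟨
    (b y x + b y y) + (O + b x y)            ≡⟨ cong (λ z → (b y x + b y y) + (z + b x y)) (b-alternating x) ⟨
    (b y x + b y y) + (b x x + b x y)        ≡⟨ cong₂ _+_ (S.+-right y x y) (S.+-right x x y) ⟨
    b y (x ⊕ y) + b x (x ⊕ y)                ≡⟨ S.+-left y x (x ⊕ y) ⟨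
    b (y ⊕ x) (x ⊕ y)                        ≡⟨ cong (λ z → b z (x ⊕ y)) (⊕-comm y x) ⟩
    b (x ⊕ y) (x ⊕ y)                        ≡⟨ b-alternating (x ⊕ y) ⟩
    O                                        ∎)
    where
    open ≡-Reasoning
    module S = Sesquilinear b-bilinear

  b-nonDegenerate : P₄.NonDegenerate b
  b-nonDegenerate x bx≡O = nonDegenerate x λ y → trans (h-b x y) (bx≡O (σ y))

  baer₀ : BaerSubgeometry
  baer₀ = record
    { basis       = frameOf p
    ; independent = λ c φc≡𝟎 → φ-injective (trans φc≡𝟎 (sym φ-𝟎))
    }

  open BaerSubgeometry baer₀ using (embed; pointSet)
  open Embedding baer₀

  σ-embed : ∀ u → σ (embed u) ≡ embed u
  σ-embed u = cong φ (trans (cong conjᵥ (ψ-φ (Vec.map ι u))) (conj-ι u))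

  b-embed : ∀ u v → b (embed u) (embed v) ≡ ι (A₀ u v)
  b-embed u v = trans (isometry (Vec.map ι u) (conjᵥ (ψ (embed v))))
    (trans (cong (λ c → h₀ (Vec.map ι u) (conjᵥ c)) (ψ-φ (Vec.map ι v))) (h₀-ι u v))

  private
    perp-∝ : ∀ {θ f} → P₄.IsSesquilinear θ f → ∀ x (P : Point 3) → f x (vec P) ≡ O → ∀ P′ → P ≈ₚ P′ → f x (vec P′) ≡ O
    perp-∝ {θ} {f} sesq x P fxP P′ P≈P′ with c , P′≡ ← ∝-sym P P′ P≈P′ = begin
      f x (vec P′)         ≡⟨ cong (f x) P′≡ ⟩
      f x (c • vec P)      ≡⟨ P₄.IsSesquilinear.•-right sesq c x (vec P) ⟩
      θ c * f x (vec P)    ≡⟨ cong (θ c *_) fxP ⟩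
      θ c * O              ≡⟨ GF4-Properties.*-zeroʳ (θ c) ⟩
      O                    ∎
      where open ≡-Reasoning

    ≈-refl : ∀ P → P ≈ₚ P
    ≈-refl P = Setoid.refl (P₄.points 3) {P}

  open P₄.SemilinearInvolution σ-involution using (apply; Fixed)

  -- The coordinates of a fixed point are conjugate to a multiple of themselves; `hilbert90` turns
  -- them into a multiple of a vector over GF(2).
  fixed⇒baer : ∀ {P} → Fixed P → pointSet P
  fixed⇒baer {P} (c , eq) =
    real (hilbert90 (ψ (vec P)) c (trans (sym (ψ-σ (vec P))) (trans (cong ψ eq) (ψ-• c (vec P)))))
    where
    real : (∃ λ u → ψ (vec P) ≡ c • Vec.map ι u) → pointSet P
    real (u , ψP≡) = record { vec = u ; nonzero = u≢𝟘 } , _ , c , P≡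
      where
      P≡ : vec P ≡ c • embed u
      P≡ = trans (sym (φ-ψ (vec P))) (trans (cong φ ψP≡) (φ-• c (Vec.map ι u)))
      u≢𝟘 : u ≢ 𝟘
      u≢𝟘 refl = nonzero P (trans P≡ (trans (cong (c •_) φ-𝟎) (•-zeroʳ c)))

  baer⇒fixed : ∀ {P} → pointSet P → Fixed P
  baer⇒fixed {P} (u , _ , P∝u@(c , P≡)) = Setoid.trans (P₄.points 3) {apply P} {point u} {P}
    (conj c , trans (cong σ P≡) (trans (σ-• c (embed (P₂.vec u))) (cong (conj c •_) (σ-embed (P₂.vec u)))))
    (∝-sym P (point u) P∝u)

  subquadrangle : SymplecticSubquadrangle ⊥
  subquadrangle = record
    { baer     = baer₀
    ; polarity = A₀-polarity
    ; ⊥̃        = record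
      { form = b ; bilinear = b-bilinear ; alternating = b-alternating ; nonDegenerate = b-nonDegenerate }
    ; σ        = σ-involution
    ; extends  = λ u v → mk⇔
        (λ perp → trans (b-embed (P₂.vec u) (P₂.vec v)) (cong ι perp))
        (λ perp → ι-zero (trans (sym (b-embed (P₂.vec u) (P₂.vec v))) perp))
    -- By the definition of `b`, the ⊥̃-polar of P is the hyperplane ⊥-perpendicular to `apply P`.
    -- The next field uses `h-b` to exchange the roles of `h` and `b`.
    ; ⊥̃⊥≐σ     = λ P → polar-of-hyperplane sesquilinear GF4-Properties.conj-* hermitian nonDegenerate
        (apply P) (polar b (P ≈ₚ_)) (λ R R∈ → R∈ P (≈-refl P)) (λ R → perp-∝ b-bilinear (vec R) P)
    ; ⊥⊥̃≐σ     = λ P → polar-of-hyperplane b-bilinear (λ _ _ → refl) b-symmetric b-nonDegenerate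
        (apply P) (polar h (P ≈ₚ_))
        (λ R R∈ → trans (sym (h-b (vec R) (vec P))) (R∈ P (≈-refl P)))
        (λ R bRσP → perp-∝ sesquilinear (vec R) P (trans (h-b (vec R) (vec P)) bRσP))
    ; fixed    = (λ {P} → fixed⇒baer {P}) , λ {P} → baer⇒fixed {P}
    }
    where
    ι-zero : ∀ {x} → ι x ≡ O → x ≡ false
    ι-zero {false} _ = refl

  vertex : Vertex ⊥
  vertex = subquadrangle , record
    { quadraticForm = Q₀-form ; isElliptic = Q₀-elliptic ; tangents = Q₀-tangent⇔isotropic }

  vertex-hasPentad : HasPentad vertex ys
  vertex-hasPentad = subst (HasPentad vertex) φ-pentad record
    { isPentad = subst (IsPentad h) (sym φ-pentad) p
    ; ovoid    = ovoid-list subquadrangle (proj₂ vertex) Q₀-points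
    ; baer     = baer-list subquadrangle (proj₂ vertex) Q₀-points
    }

-- Enumeration of the pentads

module _ {a} {A : Set a} where

  AllPairs-resp-↭ : ∀ {r} {R : Rel A r} → Symmetric R → ∀ {xs ys} → xs ↭ ys → AllPairs R xs → AllPairs R ys
  AllPairs-resp-↭ s Perm.refl         ps                         = ps
  AllPairs-resp-↭ s (Perm.prep x p)   (px ∷ ps)                  = Perm.All-resp-↭ p px ∷ AllPairs-resp-↭ s p ps
  AllPairs-resp-↭ s (Perm.swap x y p) ((pxy ∷ px) ∷ (py ∷ ps))   =
    (s pxy ∷ Perm.All-resp-↭ p py) ∷ (Perm.All-resp-↭ p px ∷ AllPairs-resp-↭ s p ps)
  AllPairs-resp-↭ s (Perm.trans p q)  ps                         = AllPairs-resp-↭ s q (AllPairs-resp-↭ s p ps)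

  extract : ∀ {x : A} {xs} → x ∈ xs → ∃ λ ys → xs ↭ x ∷ ys
  extract {x} x∈ = let as , bs , eq = ∈-∃++ x∈ in
    as ++ bs , ↭-trans (↭-reflexive eq) (Perm.shift x as bs)

  sums-↭ : ∀ {_∙_ : A → A → A} → (∀ x y → x ∙ y ≡ y ∙ x) → ∀ {xs ys} → xs ↭ ys → sums _∙_ xs ↭ sums _∙_ ys
  sums-↭ comm Perm.refl = ↭-refl
  sums-↭ {_∙_} comm (Perm.prep x p) = Perm.++⁺ (Perm.map⁺ (x ∙_) p) (sums-↭ comm p)
  sums-↭ {_∙_} comm {x ∷ y ∷ xs} {_ ∷ _ ∷ ys} (Perm.swap x y p) = ↭-trans
    (↭-reflexive (cong (_∷ (List.map (x ∙_) xs ++ List.map (y ∙_) xs ++ sums _∙_ xs)) (comm x y)))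
    (Perm.prep (y ∙ x) (↭-trans
      (Perm.++⁺ (Perm.map⁺ (x ∙_) p) (Perm.++⁺ (Perm.map⁺ (y ∙_) p) (sums-↭ comm p)))
      (Perm.shifts (List.map (x ∙_) ys) (List.map (y ∙_) ys))))
  sums-↭ comm (Perm.trans p q) = ↭-trans (sums-↭ comm p) (sums-↭ comm q)

  module Cliques {r} {R : Rel A r} (R? : ∀ x y → Dec (R x y)) where

    cliques : ℕ → List A → List (List A)
    cliques zero    xs       = [] ∷ []
    cliques (suc n) []       = []
    cliques (suc n) (x ∷ xs) = List.map (x ∷_) (cliques n (filter (R? x) xs)) ++ cliques (suc n) xs

    cliques-sound : ∀ n xs {zs} → zs ∈ cliques n xs → length zs ≡ n × zs ⊆ xs × AllPairs R zs
    cliques-sound zero    xs       (here refl) = refl , (λ ()) , []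
    cliques-sound (suc n) (x ∷ xs) zs∈ with ∈-++⁻ (List.map (x ∷_) (cliques n (filter (R? x) xs))) zs∈
    ... | inj₂ zs∈ = let len , zs⊆ , pairs = cliques-sound (suc n) xs zs∈ in len , there ∘ zs⊆ , pairs
    ... | inj₁ zs∈ with ys , ys∈ , refl ← ∈-map⁻ (x ∷_) zs∈ =
      let len , ys⊆ , pairs = cliques-sound n (filter (R? x) xs) ys∈
          member : ∀ {y} → y ∈ ys → y ∈ xs × R x y
          member y∈ = ∈-filter⁻ (R? x) {xs = xs} (ys⊆ y∈)
      in cong suc len , (λ { (here refl) → here refl ; (there y∈) → there (proj₁ (member y∈)) })
       , All.tabulate (proj₂ ∘ member) ∷ pairs

    module _ (_≟_ : DecidableEquality A) (symmetric : Symmetric R) where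
      open import Data.List.Membership.DecPropositional _≟_ using (_∈?_)

      private
        -- Irreflexivity on `ys` excludes repeated entries: once x has been chosen, a second copy of
        -- x would have to be related to it.
        Complete : ℕ → List A → Set _
        Complete n xs = ∀ ys → length ys ≡ n → ys ⊆ xs → All (λ y → ¬ R y y) ys → AllPairs R ys →
                        ∃ λ zs → zs ∈ cliques n xs × zs ↭ ys

        extend : ∀ {n x xs} → Complete n (filter (R? x) xs) → Complete (suc n) xs → Complete (suc n) (x ∷ xs)
        extend {n} {x} {xs} with-x without-x ys len ys⊆ irr pairs with x ∈? ys
        ... | no x∉ys = let zs , zs∈ , zs↭ = without-x ys len rest irr pairs in zs , ∈-++⁺ʳ _ zs∈ , zs↭
          where
          rest : ys ⊆ xs
          rest y∈ with ys⊆ y∈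
          ... | here refl = contradiction y∈ x∉ys
          ... | there y∈′ = y∈′
        ... | yes x∈ys with ys′ , ys↭ ← extract x∈ys
          with irrₓ ∷ irr′ ← Perm.All-resp-↭ ys↭ irr
          with pairsₓ ∷ pairs′ ← AllPairs-resp-↭ symmetric ys↭ pairs =
          let zs , zs∈ , zs↭ = with-x ys′ (ℕ.suc-injective (trans (sym (Perm.↭-length ys↭)) len)) rest irr′ pairs′
          in x ∷ zs , ∈-++⁺ˡ (∈-map⁺ (x ∷_) zs∈) , ↭-trans (Perm.prep x zs↭) (↭-sym ys↭)
          where
          rest : ys′ ⊆ filter (R? x) xs
          rest {y} y∈ with ys⊆ (Perm.∈-resp-↭ (↭-sym ys↭) (there y∈))
          ... | here refl = contradiction (All.lookup pairsₓ y∈) irrₓ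
          ... | there y∈′ = ∈-filter⁺ (R? x) y∈′ (All.lookup pairsₓ y∈)

      cliques-complete : ∀ n xs → Complete n xs
      cliques-complete zero    xs       []      _ _   _ _ = [] , here refl , ↭-refl
      cliques-complete (suc n) []       (y ∷ _) _ ys⊆ _ _ = contradiction (ys⊆ (here refl)) λ ()
      cliques-complete (suc n) (x ∷ xs)                   =
        extend (cliques-complete n (filter (R? x) xs)) (cliques-complete (suc n) xs)

-- Points as normalised vectors and as numbers

normalise : ∀ {n} → Vect n → Vect n
normalise []       = []
normalise (O  ∷ v) = O ∷ normalise v
normalise (I  ∷ v) = I ∷ v
normalise (ω  ∷ v) = I ∷ (ω² • v)
normalise (ω² ∷ v) = I ∷ (ω • v)

-- For n = 4 these are the 85 points of PG(3,4), 64 of them with first coordinate `I`.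
normalised : ∀ n → List (Vect n)
normalised zero    = []
normalised (suc n) = List.map (O ∷_) (normalised n) ++ List.map (I ∷_) (V₄.vectors n)

normalise-∈ : ∀ {x} → x ≢ 𝟎 → normalise x ∈ normalised 4
normalise-∈ {x} = from-yes (V₄.every? λ x → ¬? (x ≟ᵥ 𝟎) →-dec (normalise x ∈ᵥ? normalised 4)) x
  where open import Data.List.Membership.DecPropositional (_≟ᵥ_ {4}) using () renaming (_∈?_ to _∈ᵥ?_)

-- Base 4, least significant digit first. Numbers are used because `ℕ.≡ᵇ` is evaluated on builtin
-- integers, whereas vectors would be compared entry by entry.
encode : ∀ {n} → Vect n → ℕ
encode []       = 0
encode (O  ∷ v) = 4 ℕ.* encode v
encode (I  ∷ v) = 1 ℕ.+ 4 ℕ.* encode v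
encode (ω  ∷ v) = 2 ℕ.+ 4 ℕ.* encode v
encode (ω² ∷ v) = 3 ℕ.+ 4 ℕ.* encode v

decode : ∀ n → ℕ → Vect n
decode zero    _ = []
decode (suc n) m = digit (m % 4) ∷ decode n (m / 4)
  where
  digit : ℕ → 𝔽₄
  digit 0 = O
  digit 1 = I
  digit 2 = ω
  digit _ = ω²

decode-encode : ∀ v → decode 4 (encode v) ≡ v
decode-encode = from-yes (V₄.every? λ v → decode 4 (encode v) ≟ᵥ v)

encode-injective : ∀ {v w : Vect 4} → encode v ≡ encode w → v ≡ w
encode-injective {v} {w} eq = trans (sym (decode-encode v)) (trans (cong (decode 4) eq) (decode-encode w))

code : Vect 4 → ℕ
code v = encode (normalise v)

-- Opaque to keep the list from being expanded, as is isotropic below; only check evaluates both.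
opaque
  codes : List ℕ
  codes = List.map encode (normalised 4)

normalise-• : ∀ {a} → a ≢ O → ∀ (v : Vect 4) → normalise (a • v) ≡ normalise v
normalise-• {a} = from-yes (all? λ a → ¬? (a ≟₄ O) →-dec V₄.every? {4} λ v → normalise (a • v) ≟ᵥ normalise v) a

-- Opaque, since its normal form is huge.
opaque
  multiple-of-normalise : ∀ (v : Vect 4) →
    (∃ λ a → a ∈ scalars × a ≢ O × v ≡ a • normalise v) × (∃ λ a → a ∈ scalars × a ≢ O × normalise v ≡ a • v)
  multiple-of-normalise v = let to , from = multiples v in find to , find from
    where
    multiples : ∀ (v : Vect 4) →
      Any (λ a → a ≢ O × v ≡ a • normalise v) scalars × Any (λ a → a ≢ O × normalise v ≡ a • v) scalars
    multiples = from-yes (V₄.every? {4} λ v →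
      Any.any? (λ a → ¬? (a ≟₄ O) ×-dec (v ≟ᵥ (a • normalise v))) scalars ×-dec
      Any.any? (λ a → ¬? (a ≟₄ O) ×-dec (normalise v ≟ᵥ (a • v))) scalars)

∝-normalise : ∀ (v : Vect 4) → v ∝ normalise v × normalise v ∝ v
∝-normalise v = let (a , _ , _ , v≡) , (b , _ , _ , nv≡) = multiple-of-normalise v in (a , v≡) , (b , nv≡)

∝⇒normalise : ∀ {x y : Vect 4} → x ≢ 𝟎 → x ∝ y → normalise x ≡ normalise y
∝⇒normalise {y = y} x≢𝟎 (c , refl) = normalise-• (λ { refl → x≢𝟎 (•-zeroˡ y) }) y

∝⇒code : ∀ {x y : Vect 4} → x ≢ 𝟎 → x ∝ y → code x ≡ code y
∝⇒code x≢𝟎 x∝y = cong encode (∝⇒normalise x≢𝟎 x∝y)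

∝-trans : ∀ {x y z : Vect 4} → x ∝ y → y ∝ z → x ∝ z
∝-trans {z = z} (a , refl) (b , refl) = a * b , sym (•-assoc a b z)

code⇒∝ : ∀ {x y : Vect 4} → code x ≡ code y → x ∝ y
code⇒∝ {x} {y} eq = ∝-trans {x} {normalise x} {y} (proj₁ (∝-normalise x))
  (subst (_∝ y) (sym (encode-injective eq)) (proj₂ (∝-normalise y)))

opaque
  unfolding codes

  codes-unique : Unique codes
  codes-unique = from-yes (allPairs? (λ m n → ¬? (m ℕ.≟ n)) codes)

  code-∈ : ∀ {x : Vect 4} → x ≢ 𝟎 → code x ∈ codes
  code-∈ x≢𝟎 = ∈-map⁺ encode (normalise-∈ x≢𝟎)

  codes-sound : ∀ {m} → m ∈ codes → ∃ λ r → r ≢ 𝟎 × code r ≡ m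
  codes-sound m∈ = let r , r∈ , m≡ = ∈-map⁻ encode {xs = normalised 4} m∈
                       r≢𝟎 , eq = ∈-normalised r∈
                   in r , r≢𝟎 , trans (cong encode eq) (sym m≡)
    where
    ∈-normalised : ∀ {r} → r ∈ normalised 4 → r ≢ 𝟎 × normalise r ≡ r
    ∈-normalised = All.lookup {xs = normalised 4} (from-yes (All.all? (λ r → ¬? (r ≟ᵥ 𝟎) ×-dec (normalise r ≟ᵥ r)) (normalised 4)))

-- Point sets as bit lists

infix 4 _∈ᵇ_
_∈ᵇ_ : ℕ → List ℕ → Bool
m ∈ᵇ []       = false
m ∈ᵇ (n ∷ ns) = (m ℕ.≡ᵇ n) ∨ (m ∈ᵇ ns)

∈ᵇ⇒∈ : ∀ {m} ns → (m ∈ᵇ ns) ≡ true → m ∈ ns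
∈ᵇ⇒∈ {m} (n ∷ ns) eq with m ℕ.≟ n
... | yes m≡n = here m≡n
-- The truth value of `m ℕ.≟ n` is `m ℕ.≡ᵇ n` by definition, so `dec-false` evaluates the latter.
... | no  m≢n = there (∈ᵇ⇒∈ ns (trans (cong (_∨ (m ∈ᵇ ns)) (sym (dec-false (m ℕ.≟ n) m≢n))) eq))

∈⇒∈ᵇ : ∀ {m ns} → m ∈ ns → (m ∈ᵇ ns) ≡ true
∈⇒∈ᵇ {m} {n ∷ ns} (here m≡n) = cong (_∨ (m ∈ᵇ ns)) (dec-true (m ℕ.≟ n) m≡n)
∈⇒∈ᵇ {m} {n ∷ ns} (there m∈) = trans (cong ((m ℕ.≡ᵇ n) ∨_) (∈⇒∈ᵇ m∈)) (Bool.∨-zeroʳ (m ℕ.≡ᵇ n))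

-- A canonical form that forgets order and repetitions: sets of points can be compared by
-- propositional equality, and `common` counts intersections.
bits : List ℕ → List Bool
bits ms = List.map (_∈ᵇ ms) codes

bits-cong : ∀ ms ns → (∀ {m} → m ∈ ms → m ∈ ns) → (∀ {m} → m ∈ ns → m ∈ ms) → bits ms ≡ bits ns
bits-cong ms ns to from = List.map-cong (λ m → Bool.⇔→≡ (mk⇔
  (∈⇒∈ᵇ ∘ to ∘ ∈ᵇ⇒∈ ms) (∈⇒∈ᵇ ∘ from ∘ ∈ᵇ⇒∈ ns))) codes

bits-↭ : ∀ ms ns → ms ↭ ns → bits ms ≡ bits ns
bits-↭ ms ns p = bits-cong ms ns (Perm.∈-resp-↭ p) (Perm.∈-resp-↭ (↭-sym p))

map-≡ : ∀ {a b} {A : Set a} {B : Set b} {f g : A → B} {x} xs → List.map f xs ≡ List.map g xs → x ∈ xs → f x ≡ g x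
map-≡ (x ∷ xs) eq (here refl) = List.∷-injectiveˡ eq
map-≡ (x ∷ xs) eq (there x∈)  = map-≡ xs (List.∷-injectiveʳ eq) x∈

bits-∈ : ∀ ms ns {m} → bits ms ≡ bits ns → m ∈ codes → m ∈ ms → m ∈ ns
bits-∈ ms ns eq m∈codes m∈ms = ∈ᵇ⇒∈ ns (trans (sym (map-≡ codes eq m∈codes)) (∈⇒∈ᵇ m∈ms))

common : List Bool → List Bool → ℕ
common []           _            = 0
common (_ ∷ _)      []           = 0
common (false ∷ bs) (_ ∷ cs)     = common bs cs
common (true  ∷ bs) (false ∷ cs) = common bs cs
common (true  ∷ bs) (true  ∷ cs) = suc (common bs cs)

common-filter : ∀ {a} {A : Set a} (f g : A → Bool) xs →
  length (filter (λ x → f x ∧ g x Bool.≟ true) xs) ≡ common (List.map f xs) (List.map g xs)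
common-filter f g []       = refl
common-filter f g (x ∷ xs) with f x | g x
... | false | _     = common-filter f g xs
... | true  | false = common-filter f g xs
... | true  | true  = cong suc (common-filter f g xs)

-- The characteristic vectors, on the points of PG(3,4), of an ovoid and of its subquadrangle.
Entry : Set
Entry = List Bool × List Bool

entry : List (Vect 4) → Entry
entry ys = bits (List.map code ys) , bits (List.map code (ys ++ sums _⊕_ ys))

entry-↭ : ∀ {xs ys} → xs ↭ ys → entry xs ≡ entry ys
entry-↭ {xs} {ys} p = cong₂ _,_
  (bits-↭ (List.map code xs) (List.map code ys) (Perm.map⁺ code p))
  (bits-↭ (List.map code (xs ++ sums _⊕_ xs)) (List.map code (ys ++ sums _⊕_ ys))
    (Perm.map⁺ code (Perm.++⁺ p (sums-↭ ⊕-comm p))))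

entry-• : ∀ {a} → a ≢ O → ∀ ys → entry (List.map (a •_) ys) ≡ entry ys
entry-• {a} a≢O ys = cong₂ _,_ (cong bits (code-multiples ys))
  (cong bits (trans
    (cong (List.map code) (trans (cong (List.map (a •_) ys ++_) (sym (sums-map (a •_) (•-distribˡ a) ys)))
      (sym (List.map-++ (a •_) ys (sums _⊕_ ys)))))
    (code-multiples (ys ++ sums _⊕_ ys))))
  where
  code-multiples : ∀ ys → List.map code (List.map (a •_) ys) ≡ List.map code ys
  code-multiples ys = trans (sym (List.map-∘ ys)) (List.map-cong (λ y → cong encode (normalise-• a≢O y)) ys)

-- The table of pentads and its evaluation

open Cliques (λ x y → h₀ x y ≟₄ I)

units : List 𝔽₄
units = I ∷ ω ∷ ω² ∷ []

-- Pentads up to a common scalar: the first point of the list to occur in a pentad is represented by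
-- its normalised vector p, and then each further vector is the multiple y of a later point with h₀ p y = 1.
pentads : List (Vect 4) → List (List (Vect 4))
pentads []       = []
pentads (p ∷ ps) =
  List.map (p ∷_) (cliques 4 (filter (λ y → h₀ p y ≟₄ I) (cartesianProductWith _•_ units ps))) ++ pentads ps

opaque
  -- The 45 points of the Hermitian surface in the coordinates of a frame.
  isotropic : List (Vect 4)
  isotropic = filter (λ v → h₀ v v ≟₄ O) (normalised 4)

  ∈-isotropic : ∀ {v} → v ∈ normalised 4 → h₀ v v ≡ O → v ∈ isotropic
  ∈-isotropic = ∈-filter⁺ (λ v → h₀ v v ≟₄ O)

  all-isotropic : All (λ v → h₀ v v ≡ O) isotropic
  all-isotropic = All.all-filter (λ v → h₀ v v ≟₄ O) (normalised 4)

table : List Entry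
table = List.map entry (pentads isotropic)

e₀ : Entry
e₀ = entry pentad₀

_≟ₗ_ : DecidableEquality (List Bool)
_≟ₗ_ = List.≡-dec Bool._≟_

_≟ₑ_ : DecidableEquality Entry
_≟ₑ_ = ×-≡-dec _≟ₗ_ _≟ₗ_

Adj : Entry → Entry → Set
Adj (A , B) (A′ , B′) = common A A′ ≡ 1 × common B B′ ≡ 6

adj? : ∀ e e′ → Dec (Adj e e′)
adj? (A , B) (A′ , B′) = (common A A′ ℕ.≟ 1) ×-dec (common B B′ ℕ.≟ 6)

neighbours : Entry → List Entry → List Entry
neighbours e = filter (adj? e)

Counts : Entry → List Entry → List Entry → Set
Counts e N T = length N ≡ 40 × All (λ e′ →
  Adj e e′ × length (neighbours e′ N) ≡ 4 ⊎ e ≡ e′ ⊎ ¬ Adj e e′ × length (neighbours e′ N) ≡ 8) T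

-- N is an argument, not a local definition, so that it is evaluated only once.
counts? : ∀ e N T → Dec (Counts e N T)
counts? e N T = (length N ℕ.≟ 40) ×-dec All.all? (λ e′ →
  (adj? e e′ ×-dec (length (neighbours e′ N) ℕ.≟ 4)) ⊎-dec
  ((e ≟ₑ e′) ⊎-dec (¬? (adj? e e′) ×-dec (length (neighbours e′ N) ℕ.≟ 8)))) T

-- Rows are told apart by their ovoids alone, as vertices are; hence, within the table, an ovoid
-- fixes its subquadrangle.
Check : List Entry → Entry → Set
Check T e = length T ≡ 216 × AllPairs (λ e e′ → proj₁ e ≢ proj₁ e′) T × ¬ Adj e e × Counts e (neighbours e T) T

check? : ∀ T e → Dec (Check T e)
check? T e = (length T ℕ.≟ 216) ×-dec allPairs? (λ e e′ → ¬? (proj₁ e ≟ₗ proj₁ e′)) T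
  ×-dec ¬? (adj? e e) ×-dec counts? e (neighbours e T) T

opaque
  unfolding codes isotropic

  check : Check table e₀
  check = toWitness {a? = check? table e₀} tt

table-counts : All (λ e →
  Adj e₀ e × length (neighbours e (neighbours e₀ table)) ≡ 4 ⊎ e₀ ≡ e ⊎
  ¬ Adj e₀ e × length (neighbours e (neighbours e₀ table)) ≡ 8) table
table-counts = proj₂ (proj₂ (proj₂ (proj₂ check)))

pentad-nonzero : ∀ {θ f ys} → P₄.IsSesquilinear θ f → IsPentad f ys → All (_≢ 𝟎) ys
pentad-nonzero {f = f} {a ∷ b ∷ c ∷ d ∷ e ∷ []} sesquilinear
  (_ , _ , (ab ∷ ac ∷ ad ∷ ae ∷ _) ∷ _) =
  (λ { refl → contradiction (trans (sym (zeroˡ b)) ab) λ () }) ∷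
  (λ { refl → contradiction (trans (sym (zeroʳ a)) ab) λ () }) ∷
  (λ { refl → contradiction (trans (sym (zeroʳ a)) ac) λ () }) ∷
  (λ { refl → contradiction (trans (sym (zeroʳ a)) ad) λ () }) ∷
  (λ { refl → contradiction (trans (sym (zeroʳ a)) ae) λ () }) ∷ []
  where open Sesquilinear sesquilinear

module Search (⊥ : UnitaryPolarity 3) {w} (isFrame : Hermitian.IsFrame ⊥ w) where
  open Hermitian ⊥
  open Frame isFrame

  -- This and the sesquilinearity of `h₀` are inherited from `h` through `isometry`. Checking
  -- additivity directly would run over 256³ triples.
  h₀-hermitian : ∀ c d → h₀ d c ≡ conj (h₀ c d)
  h₀-hermitian c d = trans (sym (isometry d c)) (trans (hermitian (φ c) (φ d)) (cong conj (isometry c d)))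

  h₀-sesquilinear : P₄.IsSesquilinear conj h₀
  h₀-sesquilinear = record
    { +-left  = λ c d e → trans (sym (isometry (c ⊕ d) e)) (trans (cong (λ x → h x (φ e)) (φ-⊕ c d))
        (trans (+-left (φ c) (φ d) (φ e)) (cong₂ _+_ (isometry c e) (isometry d e))))
    ; +-right = λ c d e → trans (sym (isometry c (d ⊕ e))) (trans (cong (h (φ c)) (φ-⊕ d e))
        (trans (+-right (φ c) (φ d) (φ e)) (cong₂ _+_ (isometry c d) (isometry c e))))
    ; •-left  = λ a c d → trans (sym (isometry (a • c) d)) (trans (cong (λ x → h x (φ d)) (φ-• a c))
        (trans (•-left a (φ c) (φ d)) (cong (a *_) (isometry c d))))
    ; •-right = λ a c d → trans (sym (isometry c (a • d))) (trans (cong (h (φ c)) (φ-• a d))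
        (trans (•-right a (φ c) (φ d)) (cong (conj a *_) (isometry c d))))
    }

  private
    module S = Sesquilinear h₀-sesquilinear

    isotropic-• : ∀ a c → h₀ c c ≡ O → h₀ (a • c) (a • c) ≡ O
    isotropic-• a c cc = trans (S.•-left a c (a • c)) (trans (cong (a *_)
      (trans (S.•-right a c c) (trans (cong (conj a *_) cc) (GF4-Properties.*-zeroʳ (conj a))))) (GF4-Properties.*-zeroʳ a))

    -- Every nonzero scalar of GF(4) has norm a³ = 1, so multiplication by it preserves the form and
    -- maps pentads to pentads.
    h₀-• : ∀ {a} → a ≢ O → ∀ c d → h₀ (a • c) (a • d) ≡ h₀ c d
    h₀-• {a} a≢O c d = trans (S.•-left a c (a • d)) (trans (cong (a *_) (S.•-right a c d)) (norm a a≢O (h₀ c d)))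
      where
      norm : ∀ a → a ≢ O → ∀ x → a * (conj a * x) ≡ x
      norm = from-yes (all? λ a → ¬? (a ≟₄ O) →-dec all? λ x → (a * (conj a * x)) ≟₄ x)

    ∈-units : ∀ {a} → a ≢ O → a ∈ units
    ∈-units {O}  a≢O = contradiction refl a≢O
    ∈-units {I}  _   = here refl
    ∈-units {ω}  _   = there (here refl)
    ∈-units {ω²} _   = there (there (here refl))

    *-nonzero : ∀ a b → a ≢ O → b ≢ O → a * b ≢ O
    *-nonzero = from-yes (all? λ a → all? λ b → ¬? (a ≟₄ O) →-dec (¬? (b ≟₄ O) →-dec ¬? ((a * b) ≟₄ O)))

  pentads-sound : ∀ ps → All (λ p → h₀ p p ≡ O) ps → ∀ {zs} → zs ∈ pentads ps → IsPentad h₀ zs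
  pentads-sound (p ∷ ps) (pp ∷ iso) zs∈
    with ∈-++⁻ (List.map (p ∷_) (cliques 4 (filter (λ y → h₀ p y ≟₄ I) (cartesianProductWith _•_ units ps)))) zs∈
  ... | inj₂ zs∈ = pentads-sound ps iso zs∈
  ... | inj₁ zs∈ with ys , ys∈ , refl ← ∈-map⁻ (p ∷_) zs∈ =
    let len , ys⊆ , pairs = cliques-sound 4 (filter (λ y → h₀ p y ≟₄ I) (cartesianProductWith _•_ units ps)) ys∈
        member : ∀ {y} → y ∈ ys → y ∈ cartesianProductWith _•_ units ps × h₀ p y ≡ I
        member y∈ = ∈-filter⁻ (λ y → h₀ p y ≟₄ I) {xs = cartesianProductWith _•_ units ps} (ys⊆ y∈)
    in cong suc len
     , pp ∷ All.tabulate (λ y∈ → multiple (proj₁ (member y∈)))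
     , All.tabulate (proj₂ ∘ member) ∷ pairs
    where
    multiple : ∀ {y} → y ∈ cartesianProductWith _•_ units ps → h₀ y y ≡ O
    multiple y∈ with a , q , _ , q∈ , refl ← ∈-cartesianProductWith⁻ _•_ units ps y∈ = isotropic-• a q (All.lookup iso q∈)

  -- The scalar is the one that normalises the vector of `cs` whose point comes first in `ps`. The
  -- other vectors, scaled along, lie on later points of `ps`.
  pentads-complete : ∀ ps cs → IsPentad h₀ cs → (∀ {c} → c ∈ cs → normalise c ∈ ps) →
                     ∃₂ λ zs a → zs ∈ pentads ps × a ≢ O × zs ↭ List.map (a •_) cs
  pentads-complete []       (c ∷ _) pentad normal = contradiction (normal (here refl)) λ ()
  pentads-complete (p ∷ ps) cs (len , iso , pairs) normal with Any.any? (λ c → normalise c ≟ᵥ p) cs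
  ... | no none =
    let zs , a , zs∈ , rest = pentads-complete ps cs (len , iso , pairs) λ {c} c∈ →
          remaining (normal c∈) (λ eq → none (lose c∈ eq))
    in zs , a , ∈-++⁺ʳ _ zs∈ , rest
    where
    remaining : ∀ {n} → n ∈ p ∷ ps → n ≢ p → n ∈ ps
    remaining (here n≡p) n≢p = contradiction n≡p n≢p
    remaining (there n∈) _   = n∈
  ... | yes found with c , c∈ , refl ← find found
    with cs′ , cs↭ ← extract c∈
    with a , _ , a≢O , nc≡ ← proj₂ (multiple-of-normalise c)
    with cc ∷ iso′ ← Perm.All-resp-↭ cs↭ iso
    with cpairs ∷ pairs′ ← AllPairs-resp-↭ (λ {x} {y} xy → trans (h₀-hermitian x y) (cong conj xy)) cs↭ pairs =
    let zs , zs∈ , zs↭ = cliques-complete _≟ᵥ_ (λ {x} {y} xy → trans (h₀-hermitian x y) (cong conj xy)) 4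
          (filter (λ y → h₀ p y ≟₄ I) (cartesianProductWith _•_ units ps)) (List.map (a •_) cs′)
          (trans (List.length-map (a •_) cs′) (ℕ.suc-injective (trans (sym (Perm.↭-length cs↭)) len)))
          (λ {y} → candidate {y})
          (All.map⁺ (All.map (λ {d} dd eq → contradiction (trans (sym (isotropic-• a d dd)) eq) λ ()) iso′))
          (AllPairs.map⁺ (AllPairs.map (λ {x} {y} xy → trans (h₀-• a≢O x y) xy) pairs′))
    in p ∷ zs , a , ∈-++⁺ˡ (∈-map⁺ (p ∷_) zs∈) , a≢O ,
       ↭-trans (Perm.prep p zs↭) (↭-trans (↭-reflexive (cong (_∷ List.map (a •_) cs′) nc≡)) (Perm.map⁺ (a •_) (↭-sym cs↭)))
    where
    normal′ : ∀ {d} → d ∈ cs′ → normalise d ∈ ps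
    normal′ {d} d∈ with normal (Perm.∈-resp-↭ (↭-sym cs↭) (there d∈))
    ... | there n∈ = n∈
    -- A second vector on the point of c would be a multiple of c, hence perpendicular to it, while
    -- the product has to be `I`.
    ... | here nd≡nc with b , refl ← code⇒∝ {d} {c} (cong encode nd≡nc) =
      contradiction (trans (sym (All.lookup cpairs d∈)) (trans (S.•-right b c c)
        (trans (cong (conj b *_) cc) (GF4-Properties.*-zeroʳ (conj b))))) λ ()

    candidate : List.map (a •_) cs′ ⊆ filter (λ y → h₀ p y ≟₄ I) (cartesianProductWith _•_ units ps)
    candidate y∈ with d , d∈ , refl ← ∈-map⁻ (a •_) y∈ with b , _ , b≢O , d≡ ← proj₁ (multiple-of-normalise d) =
      ∈-filter⁺ (λ y → h₀ p y ≟₄ I)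
        (subst (_∈ cartesianProductWith _•_ units ps)
          (trans (•-assoc a b (normalise d)) (cong (a •_) (sym d≡)))
          (∈-cartesianProductWith⁺ _•_ (∈-units (*-nonzero a b a≢O b≢O)) (normal′ d∈)))
        (trans (cong (λ x → h₀ x (a • d)) nc≡) (trans (h₀-• a≢O c d) (All.lookup cpairs d∈)))

  table-complete : ∀ {cs} → IsPentad h₀ cs → entry cs ∈ table
  table-complete {cs} pentad =
    let zs , a , zs∈ , a≢O , zs↭ = pentads-complete isotropic cs pentad normal
    in subst (_∈ table) (trans (entry-↭ zs↭) (entry-• a≢O cs)) (∈-map⁺ entry zs∈)
    where
    normal : ∀ {c} → c ∈ cs → normalise c ∈ isotropic
    normal {c} c∈ = let b , _ , b≢O , nc≡ = proj₂ (multiple-of-normalise c) in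
      ∈-isotropic (normalise-∈ (All.lookup (pentad-nonzero h₀-sesquilinear pentad) c∈))
        (subst (λ v → h₀ v v ≡ O) (sym nc≡) (isotropic-• b c (All.lookup (proj₁ (proj₂ pentad)) c∈)))

  table-sound : ∀ {e} → e ∈ table → ∃ λ zs → IsPentad h₀ zs × e ≡ entry zs
  table-sound e∈ = let zs , zs∈ , e≡ = ∈-map⁻ entry {xs = pentads isotropic} e∈ in
    zs , pentads-sound isotropic all-isotropic zs∈ , e≡

-- Existence of a pentad

module Existence (⊥ : UnitaryPolarity 3) where
  open Hermitian ⊥

  coefficients : ∀ {k} → Vec (Vect 4) k → Vect 4 → Vect k
  coefficients g x = Vec.map (h x) g

  coefficients-⊕ : ∀ {k} (g : Vec (Vect 4) k) x y → coefficients g (x ⊕ y) ≡ coefficients g x ⊕ coefficients g y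
  coefficients-⊕ []      x y = refl
  coefficients-⊕ (v ∷ g) x y = cong₂ _∷_ (+-left x y v) (coefficients-⊕ g x y)

  coefficients-• : ∀ {k} (g : Vec (Vect 4) k) a x → coefficients g (a • x) ≡ a • coefficients g x
  coefficients-• []      a x = refl
  coefficients-• (v ∷ g) a x = cong₂ _∷_ (•-left a x v) (coefficients-• g a x)

  -- The Gram matrix of `g` is the identity, phrased as a left inverse of taking combinations.
  Orthonormal : ∀ {k} → Vec (Vect 4) k → Set
  Orthonormal g = ∀ c → coefficients g (combination c g) ≡ c

  private
    dot-𝟎 : ∀ {n} (c : Vect n) → dot c 𝟎 ≡ O
    dot-𝟎 []      = refl
    dot-𝟎 (a ∷ c) = cong₂ _+_ (GF4-Properties.*-zeroʳ a) (dot-𝟎 c)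

    perp-combination : ∀ {k} (g : Vec (Vect 4) k) x → coefficients g x ≡ 𝟎 → ∀ c → h x (combination c g) ≡ O
    perp-combination g x x⊥g c = trans (combinationʳ c g x) (trans (cong (dot (conjᵥ c)) x⊥g) (dot-𝟎 (conjᵥ c)))

    real : ∀ x → conj x ≡ x → x ≢ I → x ≡ O
    real O _ _   = refl
    real I _ x≢I = contradiction refl x≢I

    -- The sum is the trace of `conj a * x`. For x ≠ `O` these products run through GF(4), and the
    -- trace is not identically zero.
    trace-nondegenerate : ∀ x → (∀ a → conj a * x + a * conj x ≡ O) → x ≡ O
    trace-nondegenerate = from-yes (all? λ x → all? (λ a → (conj a * x + a * conj x) ≟₄ O) →-dec (x ≟₄ O))

  orthonormal-∷ : ∀ {k} {g : Vec (Vect 4) k} {x} → Orthonormal g → coefficients g x ≡ 𝟎 → h x x ≡ I → Orthonormal (x ∷ g)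
  orthonormal-∷ {g = g} {x} orthonormal x⊥g xx (a ∷ c) = cong₂ _∷_
    (begin
      h (a • x ⊕ combination c g) x                ≡⟨ +-left (a • x) (combination c g) x ⟩
      h (a • x) x + h (combination c g) x          ≡⟨ cong₂ _+_ (trans (•-left a x x) (cong (a *_) xx)) (hermitian x (combination c g)) ⟩
      a * I + conj (h x (combination c g))         ≡⟨ cong₂ _+_ (GF4-Properties.*-identityʳ a) (cong conj (perp-combination g x x⊥g c)) ⟩
      a + O                                        ≡⟨ GF4-Properties.+-identityʳ a ⟩
      a                                            ∎)
    (begin
      coefficients g (a • x ⊕ combination c g)                         ≡⟨ coefficients-⊕ g (a • x) (combination c g) ⟩
      coefficients g (a • x) ⊕ coefficients g (combination c g)        ≡⟨ cong₂ _⊕_ (trans (coefficients-• g a x) (cong (a •_) x⊥g)) (orthonormal c) ⟩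
      a • 𝟎 ⊕ c                                                        ≡⟨ cong (_⊕ c) (•-zeroʳ a) ⟩
      𝟎 ⊕ c                                                            ≡⟨ ⊕-identityˡ c ⟩
      c                                                                ∎)
    where open ≡-Reasoning

  -- If the complement of g contained no vector of norm one, h would vanish on it, so it would be zero and
  -- x ↦ coefficients g x would embed the 256 vectors of the space into a smaller space.
  extension : ∀ {k} (g : Vec (Vect 4) k) → Orthonormal g → length (V₄.vectors k) ℕ.< length (V₄.vectors 4) →
              ∃ λ x → coefficients g x ≡ 𝟎 × h x x ≡ I
  extension g orthonormal small = decidable-stable
    (V₄.some? λ x → (coefficients g x ≟ᵥ 𝟎) ×-dec (h x x ≟₄ I)) λ none → not-injective (injective none)
    where
    open ≡-Reasoning

    -- Orthogonal projection onto the complement of `g`; the sign is a plus in characteristic 2.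
    π : Vect 4 → Vect 4
    π x = x ⊕ combination (coefficients g x) g

    π⊥ : ∀ x → coefficients g (π x) ≡ 𝟎
    π⊥ x = trans (coefficients-⊕ g x _) (trans (cong (coefficients g x ⊕_) (orthonormal (coefficients g x)))
      (⊕-self (coefficients g x)))

    module _ (none : ¬ (∃ λ x → coefficients g x ≡ 𝟎 × h x x ≡ I)) where

      norm-zero : ∀ x → coefficients g x ≡ 𝟎 → h x x ≡ O
      norm-zero x x⊥g = real (h x x) (sym (hermitian x x)) λ xx → none (x , x⊥g , xx)

      -- Polarisation: x + a y has norm zero for every scalar a, so the trace of `conj a * h x y`
      -- vanishes for every a.
      form-zero : ∀ x y → coefficients g x ≡ 𝟎 → coefficients g y ≡ 𝟎 → h x y ≡ O
      form-zero x y x⊥g y⊥g = trace-nondegenerate (h x y) λ a → begin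
        conj a * h x y + a * conj (h x y)                                ≡⟨ cong₂ _+_ (sym (•-right a x y)) (trans (cong (a *_) (sym (hermitian x y))) (sym (•-left a y x))) ⟩
        h x (a • y) + h (a • y) x                                        ≡⟨ cong₂ _+_ (sym (cong (_+ h x (a • y)) (norm-zero x x⊥g))) (trans (sym (GF4-Properties.+-identityʳ _)) (cong (h (a • y) x +_) (sym (norm-zero (a • y) (ay⊥g a))))) ⟩
        (h x x + h x (a • y)) + (h (a • y) x + h (a • y) (a • y))        ≡⟨ cong₂ _+_ (sym (+-right x x (a • y))) (sym (+-right (a • y) x (a • y))) ⟩
        h x (x ⊕ a • y) + h (a • y) (x ⊕ a • y)                          ≡⟨ +-left x (a • y) (x ⊕ a • y) ⟨
        h (x ⊕ a • y) (x ⊕ a • y)                                        ≡⟨ norm-zero (x ⊕ a • y) (trans (coefficients-⊕ g x (a • y)) (trans (cong₂ _⊕_ x⊥g (ay⊥g a)) (⊕-self 𝟎))) ⟩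
        O                                                                ∎
        where
        ay⊥g : ∀ a → coefficients g (a • y) ≡ 𝟎
        ay⊥g a = trans (coefficients-• g a y) (trans (cong (a •_) y⊥g) (•-zeroʳ a))

      -- Every y is `π y` plus a combination of `g`, and x is perpendicular to both summands.
      perp-zero : ∀ x → coefficients g x ≡ 𝟎 → x ≡ 𝟎
      perp-zero x x⊥g = nonDegenerate x λ y → let c = combination (coefficients g y) g in begin
        h x y                   ≡⟨ cong (h x) (trans (sym (⊕-identityʳ y)) (trans (cong (y ⊕_) (sym (⊕-self c))) (sym (⊕-assoc y c c)))) ⟩
        h x (π y ⊕ c)           ≡⟨ +-right x (π y) c ⟩
        h x (π y) + h x c       ≡⟨ cong₂ _+_ (form-zero x (π y) x⊥g (π⊥ y)) (perp-combination g x x⊥g (coefficients g y)) ⟩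
        O                       ∎

      injective : Injective _≡_ _≡_ (coefficients g)
      injective {x} {y} eq = begin
        x                                     ≡⟨ ⊕-zero x _ (perp-zero (π x) (π⊥ x)) ⟩
        combination (coefficients g x) g      ≡⟨ cong (λ c → combination c g) eq ⟩
        combination (coefficients g y) g      ≡⟨ ⊕-zero y _ (perp-zero (π y) (π⊥ y)) ⟨
        y                                     ∎

    not-injective : ¬ Injective _≡_ _≡_ (coefficients g)
    not-injective inj = ℕ.<⇒≱ small (V₄.injective⇒≤ inj)

  orthonormal-basis : ∃ λ (g : Vec (Vect 4) 4) → Orthonormal g
  orthonormal-basis =
    -- The powers 4^k count the coefficient vectors of length k, against the 256 vectors of the
    -- space.
    let a , on₁ = extend [] (λ { [] → refl }) (from-yes (1 ℕ.<? 256))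
        b , on₂ = extend a on₁ (from-yes (4 ℕ.<? 256))
        c , on₃ = extend b on₂ (from-yes (16 ℕ.<? 256))
    in extend c on₃ (from-yes (64 ℕ.<? 256))
    where
    extend : ∀ {k} (g : Vec (Vect 4) k) → Orthonormal g → length (V₄.vectors k) ℕ.< length (V₄.vectors 4) →
             ∃ λ (g : Vec (Vect 4) (suc k)) → Orthonormal g
    extend g orthonormal small = let x , x⊥g , xx = extension g orthonormal small in
      x ∷ g , orthonormal-∷ orthonormal x⊥g xx

  pentad-exists : ∃ (IsPentad h)
  pentad-exists = List.map (λ c → combination c g) cs , refl
    , All.map⁺ (All.map (λ {c} → trans (isometry c c)) isotropic-cs)
    , AllPairs.map⁺ (AllPairs.map (λ {c} {d} → trans (isometry c d)) pairs-cs)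
    where
    g : Vec (Vect 4) 4
    g = proj₁ orthonormal-basis
    cs : List (Vect 4)
    -- Five vectors of even weight, hence isotropic for the standard Hermitian form, since each
    -- nonzero coordinate has norm 1. Their mutual products are `I`.
    cs = ⟦ O , O , I , I ⟧ ∷ ⟦ O , O , ω , ω² ⟧ ∷ ⟦ I , I , ω² , ω ⟧ ∷ ⟦ ω , ω² , ω² , ω ⟧ ∷ ⟦ ω² , ω , ω² , ω ⟧ ∷ []
    isometry : ∀ c d → h (combination c g) (combination d g) ≡ dot (conjᵥ d) c
    isometry c d = trans (combinationʳ d g (combination c g)) (cong (dot (conjᵥ d)) (proj₂ orthonormal-basis c))
    isotropic-cs : All (λ c → dot (conjᵥ c) c ≡ O) cs
    isotropic-cs = from-yes (All.all? (λ c → dot (conjᵥ c) c ≟₄ O) cs)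
    pairs-cs : AllPairs (λ c d → dot (conjᵥ d) c ≡ I) cs
    pairs-cs = from-yes (allPairs? (λ c d → dot (conjᵥ d) c ≟₄ I) cs)

-- The graph in the coordinates of a vertex

module Coding (⊥ : UnitaryPolarity 3) (x₀ : Vertex ⊥) where
  open Vertices ⊥
  open HasPentad

  pentadOf : Vertex ⊥ → List (Vect 4)
  pentadOf x = proj₁ (hasPentad x)

  pentadOf-hasPentad : ∀ x → HasPentad x (pentadOf x)
  pentadOf-hasPentad x = proj₂ (hasPentad x)

  private
    p₀ : IsPentad h (pentadOf x₀)
    p₀ = isPentad (pentadOf-hasPentad x₀)

  open Pentad p₀
  open Search ⊥ (pentad-isFrame p₀)

  pointCode : Point 3 → ℕ
  pointCode P = code (ψ (vec P))

  listCodes : List (Vect 4) → List ℕ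
  listCodes ys = List.map code (List.map ψ ys)

  pointCode-cong : ∀ {P Q} → P ≈ₚ Q → pointCode P ≡ pointCode Q
  pointCode-cong {P} {Q} (c , P≡) = ∝⇒code (ψ-nonzero (nonzero P)) (c , trans (cong ψ P≡) (ψ-• c (vec Q)))

  ψ-∝ : ∀ {x y} → code (ψ x) ≡ code (ψ y) → x ∝ y
  ψ-∝ {x} {y} eq = let c , ψx≡ = code⇒∝ {ψ x} {ψ y} eq in c , ψ-injective (trans ψx≡ (sym (ψ-• c y)))

  ∈ₚ⇒code : ∀ P ys → vec P ∈ₚ ys → pointCode P ∈ listCodes ys
  ∈ₚ⇒code P ys P∈ = let y , y∈ , c , P≡ = find P∈ in
    subst (_∈ listCodes ys) (sym (∝⇒code (ψ-nonzero (nonzero P)) (c , trans (cong ψ P≡) (ψ-• c y))))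
      (∈-map⁺ code (∈-map⁺ ψ y∈))

  code⇒∈ₚ : ∀ P ys → pointCode P ∈ listCodes ys → vec P ∈ₚ ys
  code⇒∈ₚ P ys P∈ = let c , c∈ , P≡c = ∈-map⁻ code P∈
                        y , y∈ , c≡ψy = ∈-map⁻ ψ c∈
                    in lose y∈ (ψ-∝ (trans P≡c (cong code c≡ψy)))

  point-with-code : ∀ {m} → m ∈ codes → ∃ λ P → pointCode P ≡ m
  point-with-code m∈ = let r , r≢𝟎 , code-r = codes-sound m∈ in
    record { vec = φ r ; nonzero = φ-nonzero r≢𝟎 } , trans (cong code (ψ-φ r)) code-r

  bits-≐ : ∀ ys zs → (∀ P → vec P ∈ₚ ys → vec P ∈ₚ zs) → (∀ P → vec P ∈ₚ zs → vec P ∈ₚ ys) →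
           bits (listCodes ys) ≡ bits (listCodes zs)
  bits-≐ ys zs to from = List.map-cong-local (All.tabulate λ m∈ → let P , eq = point-with-code m∈ in
    subst (λ m → (m ∈ᵇ listCodes ys) ≡ (m ∈ᵇ listCodes zs)) eq (Bool.⇔→≡ (mk⇔
      (λ P∈ → ∈⇒∈ᵇ (∈ₚ⇒code P zs (to P (code⇒∈ₚ P ys (∈ᵇ⇒∈ (listCodes ys) P∈)))))
      (λ P∈ → ∈⇒∈ᵇ (∈ₚ⇒code P ys (from P (code⇒∈ₚ P zs (∈ᵇ⇒∈ (listCodes zs) P∈))))))))

  bits-⊆ : ∀ ys zs → bits (listCodes ys) ≡ bits (listCodes zs) → ∀ P → vec P ∈ₚ ys → vec P ∈ₚ zs
  bits-⊆ ys zs eq P P∈ = code⇒∈ₚ P zs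
    (bits-∈ (listCodes ys) (listCodes zs) eq (code-∈ (ψ-nonzero (nonzero P))) (∈ₚ⇒code P ys P∈))

  size-common : ∀ {S T : PointSet 3} ys zs → (∀ P → S P ⇔ vec P ∈ₚ ys) → (∀ P → T P ⇔ vec P ∈ₚ zs) →
                P₄.∣ S ∩ T ∣≡ common (bits (listCodes ys)) (bits (listCodes zs))
  size-common {S} {T} ys zs S⇔ T⇔ = subst (P₄.∣ S ∩ T ∣≡_)
    (common-filter (_∈ᵇ listCodes ys) (_∈ᵇ listCodes zs) codes)
    (size-coded (λ {P} {Q} → pointCode-cong {P} {Q}) (λ {P} {Q} → ψ-∝ {vec P} {vec Q})
      (Unique.filter⁺ both? codes-unique)
      (λ {P} (SP , TP) → ∈-filter⁺ both? (code-∈ (ψ-nonzero (nonzero P)))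
        (cong₂ _∧_ (∈⇒∈ᵇ (∈ₚ⇒code P ys (Equivalence.to (S⇔ P) SP)))
                   (∈⇒∈ᵇ (∈ₚ⇒code P zs (Equivalence.to (T⇔ P) TP)))))
      decode-point)
    where
    both? : Decidable (λ m → ((m ∈ᵇ listCodes ys) ∧ (m ∈ᵇ listCodes zs)) ≡ true)
    both? m = ((m ∈ᵇ listCodes ys) ∧ (m ∈ᵇ listCodes zs)) Bool.≟ true

    decode-point : ∀ {m} → m ∈ filter both? codes → ∃ λ P → (S ∩ T) P × pointCode P ≡ m
    decode-point {m} m∈ = P
      , ( Equivalence.from (S⇔ P) (code⇒∈ₚ P ys (∈ᵇ⇒∈ (listCodes ys) (at-P (listCodes ys) (Bool.∧-conicalˡ _ _ both))))
        , Equivalence.from (T⇔ P) (code⇒∈ₚ P zs (∈ᵇ⇒∈ (listCodes zs) (at-P (listCodes zs) (Bool.∧-conicalʳ (m ∈ᵇ listCodes ys) _ both)))) )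
      , code-P
      where
      both : ((m ∈ᵇ listCodes ys) ∧ (m ∈ᵇ listCodes zs)) ≡ true
      both = proj₂ (∈-filter⁻ both? {xs = codes} m∈)
      P : Point 3
      P = proj₁ (point-with-code (proj₁ (∈-filter⁻ both? {xs = codes} m∈)))
      code-P : pointCode P ≡ m
      code-P = proj₂ (point-with-code (proj₁ (∈-filter⁻ both? {xs = codes} m∈)))
      at-P : ∀ ns → (m ∈ᵇ ns) ≡ true → (pointCode P ∈ᵇ ns) ≡ true
      at-P ns = subst (λ n → (n ∈ᵇ ns) ≡ true) (sym code-P)

  baerCodes : ∀ ys → listCodes (ys ++ sums _⊕_ ys) ≡ List.map code (List.map ψ ys ++ sums _⊕_ (List.map ψ ys))
  baerCodes ys = cong (List.map code) (trans (List.map-++ ψ ys (sums _⊕_ ys))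
    (cong (List.map ψ ys ++_) (sums-map ψ ψ-⊕ ys)))

  entryOf : List (Vect 4) → Entry
  entryOf ys = bits (listCodes ys) , bits (listCodes (ys ++ sums _⊕_ ys))

  entryOf-entry : ∀ ys → entryOf ys ≡ entry (List.map ψ ys)
  entryOf-entry ys = cong (λ ms → bits (listCodes ys) , bits ms) (baerCodes ys)

  vertexCode : Vertex ⊥ → Entry
  vertexCode x = entryOf (pentadOf x)

  -- A vertex determines its pentad only up to scalar and order, but the bits depend only on the two
  -- point sets. `vertex-with-code` needs this, because `pentadOf` makes its own choice of pentad.
  entryOf-unique : ∀ {x ys zs} → HasPentad x ys → HasPentad x zs → entryOf ys ≡ entryOf zs
  entryOf-unique {x} {ys} {zs} p q = cong₂ _,_
    (bits-≐ ys zs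
      (λ P → Equivalence.to (ovoid q P) ∘ Equivalence.from (ovoid p P))
      (λ P → Equivalence.to (ovoid p P) ∘ Equivalence.from (ovoid q P)))
    (bits-≐ (ys ++ sums _⊕_ ys) (zs ++ sums _⊕_ zs)
      (λ P → Equivalence.to (baer q P) ∘ Equivalence.from (baer p P))
      (λ P → Equivalence.to (baer p P) ∘ Equivalence.from (baer q P)))

  vertexCode-∈ : ∀ x → vertexCode x ∈ table
  vertexCode-∈ x = subst (_∈ table) (sym (entryOf-entry (pentadOf x))) (table-complete
    ( trans (List.length-map ψ (pentadOf x)) len
    , All.map⁺ (All.map (λ {y} yy → trans (sym (h-ψ y y)) yy) iso)
    , AllPairs.map⁺ (AllPairs.map (λ {y} {z} yz → trans (sym (h-ψ y z)) yz) pairs)))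
    where
    len   = proj₁ (isPentad (pentadOf-hasPentad x))
    iso   = proj₁ (proj₂ (isPentad (pentadOf-hasPentad x)))
    pairs = proj₂ (proj₂ (isPentad (pentadOf-hasPentad x)))

  vertex-with-code : ∀ {e} → e ∈ table → ∃ λ x → vertexCode x ≡ e
  vertex-with-code {e} e∈ = vertex , (begin
    entryOf (pentadOf vertex)                ≡⟨ entryOf-unique (pentadOf-hasPentad vertex) vertex-hasPentad ⟩
    entryOf (List.map φ zs)                  ≡⟨ entryOf-entry (List.map φ zs) ⟩
    entry (List.map ψ (List.map φ zs))       ≡⟨ cong entry (trans (sym (List.map-∘ zs)) (trans (List.map-cong ψ-φ zs) (List.map-id zs))) ⟩
    entry zs                                 ≡⟨ e≡ ⟨
    e                                        ∎)
    where
    open ≡-Reasoning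
    zs : List (Vect 4)
    zs = proj₁ (table-sound e∈)
    pentad : IsPentad h₀ zs
    pentad = proj₁ (proj₂ (table-sound e∈))
    e≡ : e ≡ entry zs
    e≡ = proj₂ (proj₂ (table-sound e∈))
    lifted : IsPentad h (List.map φ zs)
    lifted = trans (List.length-map φ zs) (proj₁ pentad)
      , All.map⁺ (All.map (λ {c} → trans (isometry c c)) (proj₁ (proj₂ pentad)))
      , AllPairs.map⁺ (AllPairs.map (λ {c} {d} → trans (isometry c d)) (proj₂ (proj₂ pentad)))
    open StandardVertex ⊥ lifted using (vertex; vertex-hasPentad)

  private
    open Setoid (vertices ⊥) using (_≈_)

    _~_ : Vertex ⊥ → Vertex ⊥ → Set
    _~_ = Γ ⊥

  vertexCode-injective : ∀ {x y} → vertexCode x ≡ vertexCode y → x ≈ y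
  vertexCode-injective {x} {y} eq =
      (λ {P} → contained x y (cong proj₁ eq) P)
    , (λ {P} → contained y x (cong proj₁ (sym eq)) P)
    where
    contained : ∀ x y → proj₁ (vertexCode x) ≡ proj₁ (vertexCode y) → ∀ P → ovoidOf x P → ovoidOf y P
    contained x y eq P P∈ = Equivalence.from (ovoid (pentadOf-hasPentad y) P)
      (bits-⊆ (pentadOf x) (pentadOf y) eq P (Equivalence.to (ovoid (pentadOf-hasPentad x) P) P∈))

  -- Equality of vertices yields equal ovoid bits only. Both codes are rows of the table, where by
  -- `check` distinct rows have distinct ovoids, so the subquadrangle bits agree as well.
  vertexCode-cong : ∀ {x y} → x ≈ y → vertexCode x ≡ vertexCode y
  vertexCode-cong {x} {y} (x⊆y , y⊆x) =
    [ id , [ contradiction same , contradiction (sym same) ]′ ]′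
      (∈-AllPairs₂ (proj₁ (proj₂ check)) (vertexCode-∈ x) (vertexCode-∈ y))
    where
    same : proj₁ (vertexCode x) ≡ proj₁ (vertexCode y)
    same = bits-≐ (pentadOf x) (pentadOf y)
      (λ P → Equivalence.to (ovoid (pentadOf-hasPentad y) P) ∘ (λ P∈ → x⊆y {P} P∈) ∘ Equivalence.from (ovoid (pentadOf-hasPentad x) P))
      (λ P → Equivalence.to (ovoid (pentadOf-hasPentad x) P) ∘ (λ P∈ → y⊆x {P} P∈) ∘ Equivalence.from (ovoid (pentadOf-hasPentad y) P))

  adjacent⇔ : ∀ x y → x ~ y ⇔ Adj (vertexCode x) (vertexCode y)
  adjacent⇔ x y = mk⇔
    (λ (one , six) → size-unique ovoids one , size-unique baers six)
    (λ (one , six) → subst (P₄.∣ ovoidOf x ∩ ovoidOf y ∣≡_) one ovoids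
                   , subst (P₄.∣ subquadrangleOf x ∩ subquadrangleOf y ∣≡_) six baers)
    where
    X = pentadOf-hasPentad x
    Y = pentadOf-hasPentad y
    ovoids : P₄.∣ ovoidOf x ∩ ovoidOf y ∣≡ common (proj₁ (vertexCode x)) (proj₁ (vertexCode y))
    ovoids = size-common (pentadOf x) (pentadOf y) (ovoid X) (ovoid Y)
    baers : P₄.∣ subquadrangleOf x ∩ subquadrangleOf y ∣≡ common (proj₂ (vertexCode x)) (proj₂ (vertexCode y))
    baers = size-common (pentadOf x ++ sums _⊕_ (pentadOf x)) (pentadOf y ++ sums _⊕_ (pentadOf y)) (baer X) (baer Y)

  size-vertices : ∀ {S : Vertex ⊥ → Set} {es} → Unique es → es ⊆ table → (∀ x → S x ⇔ vertexCode x ∈ es) →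
                  HasSize (subsetoid (vertices ⊥) S) (length es)
  size-vertices {S} {es} unique es⊆ S⇔ = size-coded {S = vertices ⊥}
    (λ {x} {y} → vertexCode-cong {x} {y}) (λ {x} {y} → vertexCode-injective {x} {y}) unique
    (λ {x} Sx → Equivalence.to (S⇔ x) Sx)
    λ e∈ → let x , eq = vertex-with-code (es⊆ e∈) in
      x , Equivalence.from (S⇔ x) (subst (_∈ es) (sym eq) e∈) , eq

  table-unique : Unique table
  table-unique = AllPairs.map (λ ne eq → ne (cong proj₁ eq)) (proj₁ (proj₂ check))

  -- In its own frame every pentad is the standard one. This takes the place of transitivity:
  -- whatever the base vertex, its row is `e₀`.
  code-x₀ : vertexCode x₀ ≡ e₀
  code-x₀ = trans (entryOf-entry (pentadOf x₀)) (cong entry ψ-pentad)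

  neighbours₀ : List Entry
  neighbours₀ = neighbours e₀ table

  ~₀⇔ : ∀ y → x₀ ~ y ⇔ Adj e₀ (vertexCode y)
  ~₀⇔ y = subst (λ e → x₀ ~ y ⇔ Adj e (vertexCode y)) code-x₀ (adjacent⇔ x₀ y)

  neighbours₀⇔ : ∀ y → x₀ ~ y ⇔ vertexCode y ∈ neighbours₀
  neighbours₀⇔ y = mk⇔
    (λ x₀~y → ∈-filter⁺ (adj? e₀) (vertexCode-∈ y) (Equivalence.to (~₀⇔ y) x₀~y))
    (λ y∈ → Equivalence.from (~₀⇔ y) (proj₂ (∈-filter⁻ (adj? e₀) {xs = table} y∈)))

  order₀ : HasSize (vertices ⊥) 216
  order₀ = subst (HasSize (vertices ⊥)) (proj₁ check)
    (size-U (size-vertices table-unique id λ x → mk⇔ (λ _ → vertexCode-∈ x) _))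

  regular₀ : HasSize (subsetoid (vertices ⊥) (x₀ ~_)) 40
  regular₀ = subst (HasSize (subsetoid (vertices ⊥) (x₀ ~_))) (proj₁ (proj₂ (proj₂ (proj₂ check))))
    (size-vertices (Unique.filter⁺ (adj? e₀) table-unique) (Subset.filter-⊆ (adj? e₀) table) neighbours₀⇔)

  common₀ : ∀ y → HasSize (subsetoid (vertices ⊥) ((x₀ ~_) ∩ (y ~_))) (length (neighbours (vertexCode y) neighbours₀))
  common₀ y = size-vertices
    (Unique.filter⁺ (adj? (vertexCode y)) (Unique.filter⁺ (adj? e₀) table-unique))
    (λ e∈ → Subset.filter-⊆ (adj? e₀) table (Subset.filter-⊆ (adj? (vertexCode y)) neighbours₀ e∈))
    λ z → mk⇔
      (λ (x₀~z , y~z) → ∈-filter⁺ (adj? (vertexCode y)) (Equivalence.to (neighbours₀⇔ z) x₀~z) (Equivalence.to (adjacent⇔ y z) y~z))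
      (λ z∈ → let z∈₀ , adj = ∈-filter⁻ (adj? (vertexCode y)) {xs = neighbours₀} z∈ in
        Equivalence.from (neighbours₀⇔ z) z∈₀ , Equivalence.from (adjacent⇔ y z) adj)

  common₀-≡ : ∀ y {n} → length (neighbours (vertexCode y) neighbours₀) ≡ n →
              HasSize (subsetoid (vertices ⊥) ((x₀ ~_) ∩ (y ~_))) n
  common₀-≡ y eq = subst (HasSize (subsetoid (vertices ⊥) ((x₀ ~_) ∩ (y ~_)))) eq (common₀ y)

  opaque
    -- Opaque, so that the case distinctions below do not unfold the lookup in the table.
    counts₀ : ∀ y →
      (x₀ ~ y × HasSize (subsetoid (vertices ⊥) ((x₀ ~_) ∩ (y ~_))) 4) ⊎
      x₀ ≈ y ⊎
      (¬ (x₀ ~ y) × HasSize (subsetoid (vertices ⊥) ((x₀ ~_) ∩ (y ~_))) 8)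
    counts₀ y = Sum.map
      (λ (adj , four) → Equivalence.from (~₀⇔ y) adj , common₀-≡ y four)
      (Sum.map
        (λ eq → vertexCode-injective {x₀} {y} (trans code-x₀ eq))
        (λ (¬adj , eight) → ¬adj ∘ Equivalence.to (~₀⇔ y) , common₀-≡ y eight))
      (All.lookup table-counts (vertexCode-∈ y))

  irreflexive₀ : ∀ {y} → x₀ ≈ y → ¬ (x₀ ~ y)
  irreflexive₀ {y} x₀≈y x₀~y = proj₁ (proj₂ (proj₂ check))
    (subst (Adj e₀) (trans (sym (vertexCode-cong {x₀} {y} x₀≈y)) code-x₀) (Equivalence.to (~₀⇔ y) x₀~y))

  respects₀ : ∀ {y z} → y ≈ z → x₀ ~ y → x₀ ~ z
  respects₀ {y} {z} y≈z x₀~y = Equivalence.from (adjacent⇔ x₀ z)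
    (subst (Adj (vertexCode x₀)) (vertexCode-cong {y} {z} y≈z) (Equivalence.to (adjacent⇔ x₀ y) x₀~y))

theorem3p5 : (⊥ : UnitaryPolarity 3) → IsStronglyRegular (vertices ⊥) (Γ ⊥) 216 40 4 8
theorem3p5 ⊥ = record
  { respects     = (λ {x} {y} {z} → respects₀ x {y} {z})
                 , (λ {x} {y} {z} y≈z y~x → symmetric {x} {z} (respects₀ x {y} {z} y≈z (symmetric {y} {x} y~x)))
  ; irreflexive  = λ {x} {y} → irreflexive₀ x {y}
  ; symmetric    = λ {x} {y} → symmetric {x} {y}
  ; connected    = connected
  -- The order is counted from a base vertex, and no vertex is given here; the other fields count
  -- from one of their arguments.
  ; order        = order₀ (StandardVertex.vertex ⊥ (proj₂ (Existence.pentad-exists ⊥)))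
  ; regular      = regular₀
  ; adjacent     = adjacent
  ; non-adjacent = non-adjacent
  }
  where
  open Coding ⊥
  open Setoid (vertices ⊥) using (_≈_)

  _~_ : Vertex ⊥ → Vertex ⊥ → Set
  _~_ = Γ ⊥

  symmetric : ∀ {x y} → x ~ y → y ~ x
  symmetric (one , six) = size-≐ (swap , swap) one , size-≐ (swap , swap) six

  connected : ∀ x y → Star (λ a b → a ≈ b ⊎ a ~ b) x y
  connected x y with counts₀ x y
  ... | inj₁ (x~y , _)          = inj₂ x~y ◅ ε
  ... | inj₂ (inj₁ x≈y)         = inj₁ x≈y ◅ ε
  -- Eight common neighbours provide at least one, hence a path of length two.
  ... | inj₂ (inj₂ (_ , eight)) = let z , x~z , y~z = Inverse.from eight Fin.zero in
    _◅_ {j = z} (inj₂ x~z) (inj₂ (symmetric {y} {z} y~z) ◅ ε)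

  adjacent : ∀ x y → x ~ y → HasSize (subsetoid (vertices ⊥) ((x ~_) ∩ (y ~_))) 4
  adjacent x y x~y with counts₀ x y
  ... | inj₁ (_ , four)        = four
  ... | inj₂ (inj₁ x≈y)        = contradiction x~y (irreflexive₀ x {y} x≈y)
  ... | inj₂ (inj₂ (x≁y , _))  = contradiction x~y x≁y

  non-adjacent : ∀ x y → ¬ (x ≈ y) → ¬ (x ~ y) → HasSize (subsetoid (vertices ⊥) ((x ~_) ∩ (y ~_))) 8
  non-adjacent x y x≉y x≁y with counts₀ x y
  ... | inj₁ (x~y , _)          = contradiction x~y x≁y
  ... | inj₂ (inj₁ x≈y)         = contradiction x≈y x≉y
  ... | inj₂ (inj₂ (_ , eight)) = eight
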